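{- Let $k\ge1$ and $n$ be integers and let $1\le s_1<s_2<\ldots<s_k<n$ be integers. Let $G=C_{2n}(s_1,\ldots,s_k,n)$ be the circulant graph and $\widetilde{G}$ the cone over $G$. Then $Jac(\widetilde{G})$ is isomorphic to $$\mathrm{coker}\Big(\mathcal{A}^n-(2k+2)I+\sum_{j=1}^{k}(\mathcal{A}^{s_j}+\mathcal{A}^{ -s_j})\Big),$$ where $\mathcal{A}$ is the companion matrix of the bimonic Laurent polynomial $\big(2k+2-\sum_{j=1}^{k}(z^{s_j}+z^{ -s_j})\big)^2-1$ and $I$ is the identity matrix of the same size as $\mathcal{A}$.
   Context: The circulant graph $C_{2n}(s_1,\ldots,s_k,n)$ has vertices $0,1,\ldots,2n-1$, with vertex $i$ adjacent to $i\pm s_1,\ldots,i\pm s_k$ and $i+n \pmod{2n}$ (so each vertex has degree $2k+1$). The cone over a graph $G$ is obtained by adding a new vertex joined by a single edge to every vertex of $G$. For a connected graph $H$ on $m$ vertices with Laplacian $L(H)=D(H)-A(H)$, the Jacobian $Jac(H)$ is the torsion subgroup of $\mathbb{Z}^m/\mathrm{im}\,L(H)$. For a bimonic integer Laurent polynomial $P(z)=z^{p}+a_1z^{p+1}+\ldots+a_{s-1}z^{p+s-1}+z^{p+s}$ ($s>0$), its companion matrix is the $s\times s$ integer matrix with first $s-1$ rows $(0\mid I_{s-1})$ and last row $(-1,-a_1,\ldots,-a_{s-1})$; it is invertible over $\mathbb{Z}$. For a square integer matrix $M$ of size $s$, $\mathrm{coker}\,M=\mathbb{Z}^s/\mathrm{im}\,M$.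 -}

module Defs where

open import Data.Nat as ℕ using (ℕ; zero; suc; _<_; _≤_; _<?_)
open import Data.Nat.Divisibility using (_∣?_)
open import Data.Integer as ℤ using (ℤ; +_; ∣_∣)
open import Data.Fin as F using (Fin; toℕ)
open import Data.List using (List; []; _∷_; _++_; length; filter; replicate; map; reverse)
open import Data.Product using (Σ; ∃; _×_; _,_; proj₁)
open import Relation.Nullary using (yes; no)
open import Data.Unit using (⊤)
open import Data.Bool using (Bool; true; false; if_then_else_)
open import Relation.Binary.PropositionalEquality using (_≡_)

ΣFin : {A : Set} → (A → A → A) → A → (m : ℕ) → (Fin m → A) → A
ΣFin _⊕_ e zero    f = e
ΣFin _⊕_ e (suc m) f = f F.zero ⊕ ΣFin _⊕_ e m (λ i → f (F.suc i))

sumℤ : (m : ℕ) → (Fin m → ℤ) → ℤ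
sumℤ = ΣFin ℤ._+_ (+ 0)

sumℕ : (m : ℕ) → (Fin m → ℕ) → ℕ
sumℕ = ΣFin ℕ._+_ 0

Vector : ℕ → Set
Vector m = Fin m → ℤ

Matrix : ℕ → Set
Matrix m = Fin m → Fin m → ℤ

module _ {m : ℕ} where

  _·ᵥ_ : Matrix m → Vector m → Vector m
  (M ·ᵥ x) i = sumℤ m (λ j → M i j ℤ.* x j)

  _·ₘ_ : Matrix m → Matrix m → Matrix m
  (M ·ₘ N) i j = sumℤ m (λ l → M i l ℤ.* N l j)

  _+ₘ_ : Matrix m → Matrix m → Matrix m
  (M +ₘ N) i j = M i j ℤ.+ N i j

  _-ₘ_ : Matrix m → Matrix m → Matrix m
  (M -ₘ N) i j = M i j ℤ.- N i j

  _*ₛ_ : ℤ → Matrix m → Matrix m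
  (c *ₛ M) i j = c ℤ.* M i j

  Iₘ : Matrix m
  Iₘ i j with i F.≟ j
  ... | yes _ = + 1
  ... | no  _ = + 0

  _^ₘ_ : Matrix m → ℕ → Matrix m
  M ^ₘ zero  = Iₘ
  M ^ₘ suc e = M ·ₘ (M ^ₘ e)

  sumₘ : (k : ℕ) → (Fin k → Matrix m) → Matrix m
  sumₘ k f i j = sumℤ k (λ t → f t i j)

InIm : {m : ℕ} → Matrix m → Vector m → Set
InIm {m} M v = ∃ λ (x : Vector m) → ∀ i → (M ·ᵥ x) i ≡ v i

_≈⟨_⟩_ : {m : ℕ} → Vector m → Matrix m → Vector m → Set
v ≈⟨ M ⟩ w = InIm M (λ i → v i ℤ.- w i)

-- A finitely presented abelian group ℤ^m / im M restricted to a subset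
-- of representatives (carrier predicate), with addition on representatives.
record PresGroup : Set₁ where
  field
    dim  : ℕ
    rel  : Matrix dim
    Elem : Vector dim → Set

Coker : {s : ℕ} → Matrix s → PresGroup
Coker {s} M = record { dim = s ; rel = M ; Elem = λ _ → ⊤ }

Torsion : {m : ℕ} → Matrix m → Vector m → Set
Torsion L v = ∃ λ (d : ℕ) → 1 ≤ d × InIm L (λ i → + d ℤ.* v i)

JacOf : {m : ℕ} → Matrix m → PresGroup
JacOf {m} L = record { dim = m ; rel = L ; Elem = Torsion L }

Carrier : PresGroup → Set
Carrier G = Σ (Vector (PresGroup.dim G)) (PresGroup.Elem G)

_∼[_]_ : {G : PresGroup} → Carrier G → (H : PresGroup) → Carrier G → Set
_∼[_]_ {G} x _ y = proj₁ x ≈⟨ PresGroup.rel G ⟩ proj₁ y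

record _≅_ (G H : PresGroup) : Set where
  field
    f        : Carrier G → Carrier H
    cong     : ∀ x y → _∼[_]_ {G} x G y → _∼[_]_ {H} (f x) H (f y)
    hom      : ∀ x y z → (∀ i → proj₁ z i ≡ proj₁ x i ℤ.+ proj₁ y i) →
               ∀ w → (∀ i → proj₁ w i ≡ proj₁ (f x) i ℤ.+ proj₁ (f y) i) →
               _∼[_]_ {H} (f z) H w
    injective  : ∀ x y → _∼[_]_ {H} (f x) H (f y) → _∼[_]_ {G} x G y
    surjective : ∀ y → ∃ λ x → _∼[_]_ {H} (f x) H y

Adj : ℕ → Set
Adj m = Fin m → Fin m → ℕ

degree : {m : ℕ} → Adj m → Fin m → ℕ
degree {m} A u = sumℕ m (A u)

laplacian : {m : ℕ} → Adj m → Matrix m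
laplacian A u v with u F.≟ v
... | yes _ = + degree A u ℤ.- + A u v
... | no  _ = ℤ.- (+ A u v)

cone : {m : ℕ} → Adj m → Adj (suc m)
cone A F.zero    F.zero    = 0
cone A F.zero    (F.suc v) = 1
cone A (F.suc u) F.zero    = 1
cone A (F.suc u) (F.suc v) = A u v

circulant : (N : ℕ) → List ℤ → Adj N
circulant N ds u v =
  length (filter (λ d → N ∣? ∣ (+ toℕ u ℤ.+ d) ℤ.- + toℕ v ∣) ds)

circJumps : (n k : ℕ) → (Fin k → ℕ) → List ℤ
circJumps n k s = + n ∷ ΣFin _++_ [] k (λ j → + s j ∷ ℤ.- (+ s j) ∷ [])

Circ : (n k : ℕ) → (Fin k → ℕ) → Adj (2 ℕ.* n)
Circ n k s = circulant (2 ℕ.* n) (circJumps n k s)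

-- Integer Laurent polynomials:  laurent p (c₀ ∷ … ∷ c_r ∷ [])
-- denotes  c₀ z^p + c₁ z^(p+1) + … + c_r z^(p+r)

record Laurent : Set where
  constructor laurent
  field
    low    : ℤ
    coeffs : List ℤ
open Laurent public

addList : List ℤ → List ℤ → List ℤ
addList []       ys       = ys
addList xs       []       = xs
addList (x ∷ xs) (y ∷ ys) = (x ℤ.+ y) ∷ addList xs ys

mulList : List ℤ → List ℤ → List ℤ
mulList []       ys = []
mulList (x ∷ xs) ys = addList (map (x ℤ.*_) ys) (+ 0 ∷ mulList xs ys)

zeros : ℕ → List ℤ
zeros n = replicate n (+ 0)

_+L_ : Laurent → Laurent → Laurent
laurent p xs +L laurent q ys with p ℤ.≤? q
... | yes _ = laurent p (addList xs (zeros ∣ q ℤ.- p ∣ ++ ys))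
... | no  _ = laurent q (addList (zeros ∣ p ℤ.- q ∣ ++ xs) ys)

_*L_ : Laurent → Laurent → Laurent
laurent p xs *L laurent q ys = laurent (p ℤ.+ q) (mulList xs ys)

negL : Laurent → Laurent
negL (laurent p xs) = laurent p (map ℤ.-_ xs)

constL : ℤ → Laurent
constL c = laurent (+ 0) (c ∷ [])

monoL : ℤ → Laurent
monoL e = laurent e (+ 1 ∷ [])

zeroL : Laurent
zeroL = laurent (+ 0) []

sumL : (k : ℕ) → (Fin k → Laurent) → Laurent
sumL = ΣFin _+L_ zeroL

leadZeros : List ℤ → ℕ
leadZeros []       = 0
leadZeros (x ∷ xs) with x ℤ.≟ + 0
... | yes _ = suc (leadZeros xs)
... | no  _ = 0

dropZeros : List ℤ → List ℤ
dropZeros []       = []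
dropZeros (x ∷ xs) with x ℤ.≟ + 0
... | yes _ = dropZeros xs
... | no  _ = x ∷ xs

normalize : Laurent → Laurent
normalize (laurent p xs) =
  laurent (p ℤ.+ + leadZeros xs) (reverse (dropZeros (reverse (dropZeros xs))))

Bimonic : Laurent → Set
Bimonic P = ∃ λ (mid : List ℤ) → coeffs (normalize P) ≡ + 1 ∷ (mid ++ (+ 1 ∷ []))

span : Laurent → ℕ
span P = length (coeffs (normalize P)) ℕ.∸ 1

nth : List ℤ → ℕ → ℤ
nth []       _       = + 0
nth (x ∷ xs) zero    = x
nth (x ∷ xs) (suc i) = nth xs i

-- companion matrix: first s-1 rows (0 | I_{s-1}), last row (-1, -a₁, …, -a_{s-1})
-- (the j-th entry of the last row is minus the coefficient of z^(p+j))
companion : (P : Laurent) → Matrix (span P)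
companion P i j with suc (toℕ i) <? span P
... | yes _ with toℕ j ℕ.≟ suc (toℕ i)
...   | yes _ = + 1
...   | no  _ = + 0
companion P i j | no _ = ℤ.- nth (coeffs (normalize P)) (toℕ j)

baseL : (k : ℕ) → (Fin k → ℕ) → Laurent
baseL k s = constL (+ (2 ℕ.* k ℕ.+ 2)) +L
            negL (sumL k (λ j → monoL (+ s j) +L monoL (ℤ.- (+ s j))))

polyP : (k : ℕ) → (Fin k → ℕ) → Laurent
polyP k s = (baseL k s *L baseL k s) +L negL (constL (+ 1))

-- A^n - (2k+2) I + Σ_j (A^{s_j} + B^{s_j}),  B = A^{-1}
cokerMatrix : (n k : ℕ) → (s : Fin k → ℕ) → {m : ℕ} → (A B : Matrix m) → Matrix m
cokerMatrix n k s A B =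
  ((A ^ₘ n) -ₘ ((+ (2 ℕ.* k ℕ.+ 2)) *ₛ Iₘ)) +ₘ sumₘ k (λ j → (A ^ₘ s j) +ₘ (B ^ₘ s j))

-- Put q(z) = 2k+2 − Σ (z^{s_j} + z^{−s_j}).  Deleting the cone vertex identifies the Jacobian with the cokernel of
-- q(T) − Tⁿ on ℤ^{2n}, where T is the cyclic shift; this matrix is strictly diagonally dominant, so the cokernel is
-- torsion and the Jacobian consists of the classes of the vectors with coordinate sum 0.
--
-- Both cokernels are cyclic ℤ[z,z⁻¹]-modules on which zⁿ acts as q(z).  On such a module z^{2n} acts as q(z)², hence
-- z^{2n} = 1 on the generator if and only if q(z)² − 1 = 0 on it.  The first relation holds in ℤ^{2n}, where the
-- generator is δ₀, the second one in ℤ^s with the companion matrix, where the generator is the last basis vector, so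
-- each generator satisfies the relations that define the other module.  This gives two mutually inverse homomorphisms:
-- ψ sends δ_u to 𝒜^{−u} applied to the generator of ℤ^s, and χ sends the j-th basis vector of ℤ^s to the (j+1)-st
-- Horner tail of the normalised polynomial q² − 1, evaluated at T and applied to δ₀.

module Submission where

open import Defs
open import Data.Nat as ℕ using (ℕ; zero; suc; _≤_; _<_; z≤n; s≤s)
import Data.Nat.Properties as ℕ
open import Data.Integer as ℤ using (ℤ; +_; -[1+_]; _+_; _-_; _*_; -_; ∣_∣)
import Data.Integer.Properties as ℤ
open import Data.Integer.DivMod using (_/ℕ_; n%ℕd<d; a≡a%ℕn+[a/ℕn]*n)
open import Data.Integer.Divisibility.Signed as Signed using (∣ᵤ⇒∣)
open import Data.Nat.Divisibility using (_∣_; divides; _∣?_; >⇒∤)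
open import Data.Integer.Tactic.RingSolver using (solve-∀)
open import Data.Nat.Tactic.RingSolver using () renaming (solve-∀ to ℕ-solve-∀)
open import Data.Fin as F using (Fin; toℕ)
import Data.Fin.Properties as F
open import Algebra.Properties.CommutativeMonoid.Sum ℤ.+-0-commutativeMonoid using (sum; sum-remove)
open import Data.Vec.Functional using (insertAt)
open import Data.Vec.Functional.Properties using (insertAt-lookup; insertAt-punchIn)
open import Data.List using (List; []; _∷_; _++_; length; drop; map; reverse)
import Data.List.Properties as List
open import Data.Product using (∃; _×_; _,_; proj₁; proj₂)
open import Data.Sum using (_⊎_; inj₁; inj₂)
open import Data.Unit using (tt)
open import Algebra.Properties.AbelianGroup ℤ.+-0-abelianGroup using (∙-cancelʳ)
open import Data.Empty using (⊥-elim)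
open import Function using (_∘_)
open import Relation.Nullary using (Dec; yes; no; ¬?)
open import Relation.Binary.PropositionalEquality
  using (_≡_; _≢_; refl; sym; trans; cong; cong₂; subst; _≗_; module ≡-Reasoning)

-- Each group is given only as a free abelian group modulo the image of one linear map `M` = zⁿ -
-- q(z), and each of the two relations holds exactly on one side only: z^{2n} fixes δ₀ on the nose
-- in ℤ^{2n}, and q² - 1 kills the generator on the nose in ℤ^s. On the other side each holds just
-- modulo im `M`. So ψ and χ commute with z only modulo im `M` of their target, and the argument
-- works with this congruence throughout, checking it on basis vectors. Since zⁿ acts as q(z) on
-- both quotients, a map that commutes with z in this weak sense already respects the images of `M`.
--
-- The constant 2k+2 exceeds the degree 2k+1 of the circulant graph by the one edge to the apex.
-- This surplus makes `M` injective and gives `M` b = -b on constant vectors b, which is how the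
-- apex coordinate is absorbed.
--
-- The matrix `B` is given as a right inverse of the companion matrix; injectivity of the latter
-- makes it two-sided. Bimonicity is read off the coefficient function of q² - 1, which is even and
-- has leading coefficient (-1)² = 1.

private
  variable
    I J K : Set

-- Finite sums and linear maps

δ : ℕ → ℕ → ℤ
δ zero    zero    = + 1
δ zero    (suc _) = + 0
δ (suc _) zero    = + 0
δ (suc i) (suc j) = δ i j

δ-refl : ∀ i → δ i i ≡ + 1
δ-refl zero    = refl
δ-refl (suc i) = δ-refl i

δ-sym : ∀ i j → δ i j ≡ δ j i
δ-sym zero    zero    = refl
δ-sym zero    (suc _) = refl
δ-sym (suc _) zero    = refl
δ-sym (suc i) (suc j) = δ-sym i j

δ-≢ : ∀ {i j} → i ≢ j → δ i j ≡ + 0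
δ-≢ {zero}  {zero}  i≢j = ⊥-elim (i≢j refl)
δ-≢ {zero}  {suc _} _   = refl
δ-≢ {suc _} {zero}  _   = refl
δ-≢ {suc _} {suc _} i≢j = δ-≢ (i≢j ∘ cong suc)

sum-cong : ∀ m {f g : Fin m → ℤ} → f ≗ g → sumℤ m f ≡ sumℤ m g
sum-cong zero    _   = refl
sum-cong (suc m) f≗g = cong₂ _+_ (f≗g F.zero) (sum-cong m (f≗g ∘ F.suc))

sum-0 : ∀ m {f : Fin m → ℤ} → (∀ i → f i ≡ + 0) → sumℤ m f ≡ + 0
sum-0 zero    _  = refl
sum-0 (suc m) f0 = cong₂ _+_ (f0 F.zero) (sum-0 m (f0 ∘ F.suc))

+-interchange : ∀ a b c d → (a + b) + (c + d) ≡ (a + c) + (b + d)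
+-interchange = solve-∀

*-swap : ∀ a b c → a * (b * c) ≡ b * (a * c)
*-swap = solve-∀

sum-+ : ∀ m (f g : Fin m → ℤ) → sumℤ m (λ i → f i + g i) ≡ sumℤ m f + sumℤ m g
sum-+ zero    f g = refl
sum-+ (suc m) f g =
  trans (cong (_+_ (f F.zero + g F.zero)) (sum-+ m (f ∘ F.suc) (g ∘ F.suc)))
        (+-interchange (f F.zero) (g F.zero) (sumℤ m (f ∘ F.suc)) (sumℤ m (g ∘ F.suc)))

sum-* : ∀ m c (f : Fin m → ℤ) → sumℤ m (λ i → c * f i) ≡ c * sumℤ m f
sum-* zero    c f = sym (ℤ.*-zeroʳ c)
sum-* (suc m) c f =
  trans (cong (_+_ (c * f F.zero)) (sum-* m c (f ∘ F.suc)))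
        (sym (ℤ.*-distribˡ-+ c (f F.zero) (sumℤ m (f ∘ F.suc))))

sum-const : ∀ m c → sumℤ m (λ _ → c) ≡ + m * c
sum-const zero    c = sym (ℤ.*-zeroˡ c)
sum-const (suc m) c = trans (cong (_+_ c) (sum-const m c)) (sym (ℤ.suc-* (+ m) c))

sum-swap : ∀ l m (f : Fin l → Fin m → ℤ) →
           sumℤ l (λ i → sumℤ m (f i)) ≡ sumℤ m (λ j → sumℤ l (λ i → f i j))
sum-swap zero    m f = sym (sum-0 m (λ _ → refl))
sum-swap (suc l) m f =
  trans (cong (_+_ (sumℤ m (f F.zero))) (sum-swap l m (f ∘ F.suc)))
        (sym (sum-+ m (f F.zero) (λ j → sumℤ l (λ i → f (F.suc i) j))))

sum-δ : ∀ m (f : Fin m → ℤ) (j : Fin m) → sumℤ m (λ i → δ (toℕ i) (toℕ j) * f i) ≡ f j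
sum-δ (suc m) f F.zero =
  trans (cong₂ _+_ (ℤ.*-identityˡ (f F.zero)) (sum-0 m (λ i → ℤ.*-zeroˡ (f (F.suc i)))))
        (ℤ.+-identityʳ (f F.zero))
sum-δ (suc m) f (F.suc j) =
  trans (cong₂ _+_ (ℤ.*-zeroˡ (f F.zero)) (sum-δ m (f ∘ F.suc) j))
        (ℤ.+-identityˡ (f (F.suc j)))

infixl 6 _⊕_ _⊖_
infixr 7 _⊙_

_⊕_ _⊖_ : (I → ℤ) → (I → ℤ) → I → ℤ
(x ⊕ y) i = x i + y i
(x ⊖ y) i = x i - y i

_⊙_ : ℤ → (I → ℤ) → I → ℤ
(c ⊙ x) i = c * x i

𝟎 : I → ℤ
𝟎 _ = + 0

Σᵥ : (m : ℕ) → (Fin m → I → ℤ) → I → ℤ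
Σᵥ m x i = sumℤ m (λ j → x j i)

basis : {m : ℕ} → Fin m → Fin m → ℤ
basis u i = δ (toℕ i) (toℕ u)

expansion : ∀ {m} (x : Fin m → ℤ) → x ≗ Σᵥ m (λ u → x u ⊙ basis u)
expansion {m} x i = sym (trans (sum-cong m (λ u → trans (ℤ.*-comm (x u) _)
  (cong (_* x u) (δ-sym (toℕ i) (toℕ u))))) (sum-δ m x i))

-- Vectors are functions compared pointwise, so compatibility with `≗` has to be a field of its own.
record Linear (F : (I → ℤ) → (J → ℤ)) : Set where
  field
    ≗-cong : ∀ {x y} → x ≗ y → F x ≗ F y
    ⊕-homo : ∀ x y → F (x ⊕ y) ≗ F x ⊕ F y
    ⊙-homo : ∀ c x → F (c ⊙ x) ≗ c ⊙ F x

  𝟎-homo : F 𝟎 ≗ 𝟎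
  𝟎-homo = ⊙-homo (+ 0) 𝟎

  ⊖-homo : ∀ x y → F (x ⊖ y) ≗ F x ⊖ F y
  ⊖-homo x y i =
    trans (≗-cong (λ j → cong (_+_ (x j)) (sym (ℤ.-1*i≡-i (y j)))) i)
    (trans (⊕-homo x (ℤ.-1ℤ ⊙ y) i)
    (cong (_+_ (F x i)) (trans (⊙-homo ℤ.-1ℤ y i) (ℤ.-1*i≡-i (F y i)))))

  Σ-homo : ∀ m x → F (Σᵥ m x) ≗ Σᵥ m (F ∘ x)
  Σ-homo zero    x = 𝟎-homo
  Σ-homo (suc m) x i =
    trans (⊕-homo (x F.zero) (Σᵥ m (x ∘ F.suc)) i)
          (cong (_+_ (F (x F.zero) i)) (Σ-homo m (x ∘ F.suc) i))

open Linear

linear-expansion : ∀ {m} {F : (Fin m → ℤ) → (J → ℤ)} → Linear F →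
                   ∀ x → F x ≗ Σᵥ m (λ u → x u ⊙ F (basis u))
linear-expansion {m = m} L x i =
  trans (≗-cong L (expansion x) i)
  (trans (Σ-homo L m _ i) (sum-cong m (λ u → ⊙-homo L (x u) (basis u) i)))

id-linear : Linear {I} {I} (λ x → x)
id-linear = record { ≗-cong = λ p → p ; ⊕-homo = λ _ _ _ → refl ; ⊙-homo = λ _ _ _ → refl }

𝟎-linear : Linear {I} {J} (λ _ → 𝟎)
𝟎-linear = record
  { ≗-cong = λ _ _ → refl
  ; ⊕-homo = λ _ _ _ → refl
  ; ⊙-homo = λ c _ _ → sym (ℤ.*-zeroʳ c)
  }

∘-linear : {F : (J → ℤ) → (K → ℤ)} {G : (I → ℤ) → (J → ℤ)} →
           Linear F → Linear G → Linear (F ∘ G)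
∘-linear {G = G} LF LG = record
  { ≗-cong = λ p → ≗-cong LF (≗-cong LG p)
  ; ⊕-homo = λ x y i → trans (≗-cong LF (⊕-homo LG x y) i) (⊕-homo LF (G x) (G y) i)
  ; ⊙-homo = λ c x i → trans (≗-cong LF (⊙-homo LG c x) i) (⊙-homo LF c (G x) i)
  }

⊕-linear : {F G : (I → ℤ) → (J → ℤ)} → Linear F → Linear G → Linear (λ x → F x ⊕ G x)
⊕-linear {F = F} {G} LF LG = record
  { ≗-cong = λ p i → cong₂ _+_ (≗-cong LF p i) (≗-cong LG p i)
  ; ⊕-homo = λ x y i → trans (cong₂ _+_ (⊕-homo LF x y i) (⊕-homo LG x y i))
                             (+-interchange (F x i) (F y i) (G x i) (G y i))
  ; ⊙-homo = λ c x i → trans (cong₂ _+_ (⊙-homo LF c x i) (⊙-homo LG c x i))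
                             (sym (ℤ.*-distribˡ-+ c (F x i) (G x i)))
  }

⊙-linear : ∀ a {F : (I → ℤ) → (J → ℤ)} → Linear F → Linear (λ x → a ⊙ F x)
⊙-linear a {F} LF = record
  { ≗-cong = λ p i → cong (a *_) (≗-cong LF p i)
  ; ⊕-homo = λ x y i → trans (cong (a *_) (⊕-homo LF x y i)) (ℤ.*-distribˡ-+ a (F x i) (F y i))
  ; ⊙-homo = λ c x i → trans (cong (a *_) (⊙-homo LF c x i)) (*-swap a c (F x i))
  }

⊖-linear : {F G : (I → ℤ) → (J → ℤ)} → Linear F → Linear G → Linear (λ x → F x ⊖ G x)
⊖-linear {F = F} {G} LF LG = record
  { ≗-cong = λ p i → cong₂ _-_ (≗-cong LF p i) (≗-cong LG p i)
  ; ⊕-homo = λ x y i → trans (cong₂ _-_ (⊕-homo LF x y i) (⊕-homo LG x y i))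
                             (e₁ (F x i) (F y i) (G x i) (G y i))
  ; ⊙-homo = λ c x i → trans (cong₂ _-_ (⊙-homo LF c x i) (⊙-homo LG c x i))
                             (e₂ c (F x i) (G x i))
  }
  where
  e₁ : ∀ a b c d → (a + b) - (c + d) ≡ (a - c) + (b - d)
  e₁ = solve-∀
  e₂ : ∀ c a b → c * a - c * b ≡ c * (a - b)
  e₂ = solve-∀

Σ-linear : ∀ m {F : Fin m → (I → ℤ) → (J → ℤ)} → (∀ j → Linear (F j)) →
           Linear (λ x → Σᵥ m (λ j → F j x))
Σ-linear m {F} LF = record
  { ≗-cong = λ p i → sum-cong m (λ j → ≗-cong (LF j) p i)
  ; ⊕-homo = λ x y i → trans (sum-cong m (λ j → ⊕-homo (LF j) x y i))
                             (sum-+ m (λ j → F j x i) (λ j → F j y i))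
  ; ⊙-homo = λ c x i → trans (sum-cong m (λ j → ⊙-homo (LF j) c x i))
                             (sum-* m c (λ j → F j x i))
  }

combination-linear : ∀ {m} (v : Fin m → J → ℤ) → Linear (λ x → Σᵥ m (λ u → x u ⊙ v u))
combination-linear {m = m} v = record
  { ≗-cong = λ p i → sum-cong m (λ u → cong (_* v u i) (p u))
  ; ⊕-homo = λ x y i → trans (sum-cong m (λ u → ℤ.*-distribʳ-+ (v u i) (x u) (y u)))
                             (sum-+ m (λ u → x u * v u i) (λ u → y u * v u i))
  ; ⊙-homo = λ c x i → trans (sum-cong m (λ u → ℤ.*-assoc c (x u) (v u i)))
                             (sum-* m c (λ u → x u * v u i))
  }

combination-basis : ∀ {m} (v : Fin m → J → ℤ) j → Σᵥ m (λ u → basis j u ⊙ v u) ≗ v j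
combination-basis {m = m} v j i = sum-δ m (λ u → v u i) j

matrix-linear : ∀ {m} (M : Matrix m) → Linear (M ·ᵥ_)
matrix-linear {m} M = record
  { ≗-cong = λ p i → sum-cong m (λ j → cong (M i j *_) (p j))
  ; ⊕-homo = λ x y i → trans (sum-cong m (λ j → ℤ.*-distribˡ-+ (M i j) (x j) (y j)))
                             (sum-+ m (λ j → M i j * x j) (λ j → M i j * y j))
  ; ⊙-homo = λ c x i → trans (sum-cong m (λ j → *-swap (M i j) c (x j)))
                             (sum-* m c (λ j → M i j * x j))
  }

-- Congruence modulo the image of a linear map

module Quotient {M : (I → ℤ) → (J → ℤ)} (ML : Linear M) where

  infix 4 _∼_
  infixr 4 _,_

  -- A record instead of a bare existential: `x` and `y` are then recovered from the type by
  -- unification, which the expression `x ⊖ y` would not allow.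
  record _∼_ (x y : J → ℤ) : Set where
    constructor _,_
    field
      preimage   : I → ℤ
      M-preimage : M preimage ≗ x ⊖ y

  ≗⇒∼ : ∀ {x y} → x ≗ y → x ∼ y
  ≗⇒∼ {x} {y} x≗y = 𝟎 , λ i → trans (𝟎-homo ML i) (sym (ℤ.i≡j⇒i-j≡0 {x i} {y i} (x≗y i)))

  ∼-refl : ∀ x → x ∼ x
  ∼-refl x = ≗⇒∼ {x} {x} (λ _ → refl)

  ∼-sym : ∀ {x y} → x ∼ y → y ∼ x
  ∼-sym {x} {y} (w , p) = ℤ.-1ℤ ⊙ w , λ i →
    trans (⊙-homo ML ℤ.-1ℤ w i) (trans (cong (ℤ.-1ℤ *_) (p i)) (e (x i) (y i)))
    where
    e : ∀ a b → ℤ.-1ℤ * (a - b) ≡ b - a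
    e a b = trans (ℤ.-1*i≡-i (a - b)) (e′ a b)
      where
      e′ : ∀ a b → - (a - b) ≡ b - a
      e′ = solve-∀

  ∼-trans : ∀ {x y z} → x ∼ y → y ∼ z → x ∼ z
  ∼-trans {x} {y} {z} (w , p) (w′ , p′) = w ⊕ w′ , λ i →
    trans (⊕-homo ML w w′ i) (trans (cong₂ _+_ (p i) (p′ i)) (e (x i) (y i) (z i)))
    where
    e : ∀ a b c → (a - b) + (b - c) ≡ a - c
    e = solve-∀

  ⊕-cong : ∀ {x x′ y y′} → x ∼ x′ → y ∼ y′ → x ⊕ y ∼ x′ ⊕ y′
  ⊕-cong {x} {x′} {y} {y′} (w , p) (w′ , p′) = w ⊕ w′ , λ i →
    trans (⊕-homo ML w w′ i) (trans (cong₂ _+_ (p i) (p′ i)) (e (x i) (x′ i) (y i) (y′ i)))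
    where
    e : ∀ a a′ b b′ → (a - a′) + (b - b′) ≡ (a + b) - (a′ + b′)
    e = solve-∀

  ⊙-cong : ∀ c {x y} → x ∼ y → c ⊙ x ∼ c ⊙ y
  ⊙-cong c {x} {y} (w , p) = c ⊙ w , λ i →
    trans (⊙-homo ML c w i) (trans (cong (c *_) (p i)) (e c (x i) (y i)))
    where
    e : ∀ c a b → c * (a - b) ≡ c * a - c * b
    e = solve-∀

  ⊖-cong : ∀ {x x′ y y′} → x ∼ x′ → y ∼ y′ → x ⊖ y ∼ x′ ⊖ y′
  ⊖-cong {x} {x′} {y} {y′} (w , p) (w′ , p′) = w ⊖ w′ , λ i →
    trans (⊖-homo ML w w′ i) (trans (cong₂ _-_ (p i) (p′ i)) (e (x i) (x′ i) (y i) (y′ i)))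
    where
    e : ∀ a a′ b b′ → (a - a′) - (b - b′) ≡ (a - b) - (a′ - b′)
    e = solve-∀

  Σ-cong : ∀ m {x y : Fin m → J → ℤ} → (∀ j → x j ∼ y j) → Σᵥ m x ∼ Σᵥ m y
  Σ-cong zero    _ = ∼-refl 𝟎
  Σ-cong (suc m) p = ⊕-cong (p F.zero) (Σ-cong m (p ∘ F.suc))

  linear-ext : ∀ {m} {F G : (Fin m → ℤ) → (J → ℤ)} → Linear F → Linear G →
               (∀ u → F (basis u) ∼ G (basis u)) → ∀ x → F x ∼ G x
  linear-ext {m} LF LG p x =
    ∼-trans (≗⇒∼ (linear-expansion LF x))
    (∼-trans (Σ-cong m (λ u → ⊙-cong (x u) (p u)))
             (≗⇒∼ (λ i → sym (linear-expansion LG x i))))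

-- Laurent polynomials acting through an automorphism

-- A ℤ[z,z⁻¹]-module structure on the vectors: `σ d` is multiplication by z^d. All integer powers
-- are part of the data, so that shifts and matrix powers are treated alike.
record Action (I : Set) : Set where
  field
    σ        : ℤ → (I → ℤ) → (I → ℤ)
    σ-linear : ∀ d → Linear (σ d)
    σ-0      : ∀ w → σ (+ 0) w ≗ w
    σ-+      : ∀ d e w → σ (d + e) w ≗ σ d (σ e w)

  σ-inverse : ∀ {d e} → d + e ≡ + 0 → ∀ w → σ d (σ e w) ≗ w
  σ-inverse {d} {e} p w i =
    trans (sym (σ-+ d e w i)) (trans (cong (λ c → σ c w i) p) (σ-0 w i))

  σ-comm : ∀ d e w → σ d (σ e w) ≗ σ e (σ d w)
  σ-comm d e w i = trans (sym (σ-+ d e w i))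
    (trans (cong (λ c → σ c w i) (ℤ.+-comm d e)) (σ-+ e d w i))

leadZeros-split : ∀ xs → xs ≡ zeros (leadZeros xs) ++ dropZeros xs
leadZeros-split []       = refl
leadZeros-split (x ∷ xs) with x ℤ.≟ + 0
... | yes refl = cong (_∷_ (+ 0)) (leadZeros-split xs)
... | no  _    = refl

zeros-∷ʳ : ∀ m → zeros m ++ + 0 ∷ [] ≡ + 0 ∷ zeros m
zeros-∷ʳ zero    = refl
zeros-∷ʳ (suc m) = cong (_∷_ (+ 0)) (zeros-∷ʳ m)

reverse-zeros : ∀ m → reverse (zeros m) ≡ zeros m
reverse-zeros zero    = refl
reverse-zeros (suc m) = trans (List.unfold-reverse (+ 0) (zeros m))
  (trans (cong (_++ + 0 ∷ []) (reverse-zeros m)) (zeros-∷ʳ m))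

trailZeros-split : ∀ xs → xs ≡ reverse (dropZeros (reverse xs)) ++ zeros (leadZeros (reverse xs))
trailZeros-split xs =
  trans (sym (List.reverse-involutive xs))
  (trans (cong reverse (leadZeros-split (reverse xs)))
  (trans (List.reverse-++ (zeros m) (dropZeros (reverse xs)))
         (cong (reverse (dropZeros (reverse xs)) ++_) (reverse-zeros m))))
  where
  m : ℕ
  m = leadZeros (reverse xs)

p+∣q-p∣ : ∀ p q → p ℤ.≤ q → p + + ∣ q - p ∣ ≡ q
p+∣q-p∣ p q p≤q = trans (cong (_+_ p) (ℤ.0≤i⇒+∣i∣≡i (ℤ.i≤j⇒0≤j-i p≤q))) (e p q)
  where
  e : ∀ p q → p + (q - p) ≡ q
  e = solve-∀

module Evaluation {I : Set} (𝒳 : Action I) where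

  open Action 𝒳

  evl : ℤ → List ℤ → (I → ℤ) → I → ℤ
  evl p []       w = 𝟎
  evl p (x ∷ xs) w = x ⊙ σ p w ⊕ evl (+ 1 + p) xs w

  evl-linear : ∀ p xs → Linear (evl p xs)
  evl-linear p []       = 𝟎-linear
  evl-linear p (x ∷ xs) = ⊕-linear (⊙-linear x (σ-linear p)) (evl-linear (+ 1 + p) xs)

  σ-evl : ∀ d p xs w → σ d (evl p xs w) ≗ evl (d + p) xs w
  σ-evl d p []       w = 𝟎-homo (σ-linear d)
  σ-evl d p (x ∷ xs) w i = begin
    σ d (x ⊙ σ p w ⊕ evl (+ 1 + p) xs w) i
      ≡⟨ ⊕-homo (σ-linear d) (x ⊙ σ p w) (evl (+ 1 + p) xs w) i ⟩
    σ d (x ⊙ σ p w) i + σ d (evl (+ 1 + p) xs w) i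
      ≡⟨ cong₂ _+_ (⊙-homo (σ-linear d) x (σ p w) i) (σ-evl d (+ 1 + p) xs w i) ⟩
    x * σ d (σ p w) i + evl (d + (+ 1 + p)) xs w i
      ≡⟨ cong₂ (λ a q → x * a + evl q xs w i) (sym (σ-+ d p w i)) (e d p) ⟩
    x * σ (d + p) w i + evl (+ 1 + (d + p)) xs w i ∎
    where
    open ≡-Reasoning
    e : ∀ d p → d + (+ 1 + p) ≡ + 1 + (d + p)
    e = solve-∀

  evl-addList : ∀ p xs ys w → evl p (addList xs ys) w ≗ evl p xs w ⊕ evl p ys w
  evl-addList p []       ys       w i = sym (ℤ.+-identityˡ (evl p ys w i))
  evl-addList p (x ∷ xs) []       w i = sym (ℤ.+-identityʳ (evl p (x ∷ xs) w i))
  evl-addList p (x ∷ xs) (y ∷ ys) w i =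
    trans (cong (_+_ ((x + y) * σ p w i)) (evl-addList (+ 1 + p) xs ys w i))
          (e x y (σ p w i) (evl (+ 1 + p) xs w i) (evl (+ 1 + p) ys w i))
    where
    e : ∀ x y a b c → (x + y) * a + (b + c) ≡ (x * a + b) + (y * a + c)
    e = solve-∀

  evl-map-* : ∀ p c xs w → evl p (map (c *_) xs) w ≗ c ⊙ evl p xs w
  evl-map-* p c []       w i = sym (ℤ.*-zeroʳ c)
  evl-map-* p c (x ∷ xs) w i =
    trans (cong (_+_ (c * x * σ p w i)) (evl-map-* (+ 1 + p) c xs w i))
          (e c x (σ p w i) (evl (+ 1 + p) xs w i))
    where
    e : ∀ c x a b → c * x * a + c * b ≡ c * (x * a + b)
    e = solve-∀

  evl-map-neg : ∀ p xs w i → evl p (map -_ xs) w i ≡ - evl p xs w i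
  evl-map-neg p []       w i = refl
  evl-map-neg p (x ∷ xs) w i =
    trans (cong (_+_ (- x * σ p w i)) (evl-map-neg (+ 1 + p) xs w i))
          (e x (σ p w i) (evl (+ 1 + p) xs w i))
    where
    e : ∀ x a b → - x * a + - b ≡ - (x * a + b)
    e = solve-∀

  evl-++ : ∀ p xs ys w → evl p (xs ++ ys) w ≗ evl p xs w ⊕ evl (p + + length xs) ys w
  evl-++ p []       ys w i =
    trans (cong (λ q → evl q ys w i) (sym (ℤ.+-identityʳ p)))
          (sym (ℤ.+-identityˡ (evl (p + + 0) ys w i)))
  evl-++ p (x ∷ xs) ys w i = begin
    x * σ p w i + evl (+ 1 + p) (xs ++ ys) w i
      ≡⟨ cong (_+_ (x * σ p w i)) (evl-++ (+ 1 + p) xs ys w i) ⟩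
    x * σ p w i + (evl (+ 1 + p) xs w i + evl (+ 1 + p + + length xs) ys w i)
      ≡⟨ cong (λ q → x * σ p w i + (evl (+ 1 + p) xs w i + evl q ys w i)) (e p (+ length xs)) ⟩
    x * σ p w i + (evl (+ 1 + p) xs w i + evl (p + + length (x ∷ xs)) ys w i)
      ≡⟨ sym (ℤ.+-assoc (x * σ p w i) (evl (+ 1 + p) xs w i) _) ⟩
    x * σ p w i + evl (+ 1 + p) xs w i + evl (p + + length (x ∷ xs)) ys w i ∎
    where
    open ≡-Reasoning
    e : ∀ p l → + 1 + p + l ≡ p + (+ 1 + l)
    e = solve-∀

  evl-zeros : ∀ p m w → evl p (zeros m) w ≗ 𝟎
  evl-zeros p zero    w i = refl
  evl-zeros p (suc m) w i =
    cong₂ _+_ (ℤ.*-zeroˡ (σ p w i)) (evl-zeros (+ 1 + p) m w i)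

  evl-zeros-++ : ∀ p m xs w → evl p (zeros m ++ xs) w ≗ evl (p + + m) xs w
  evl-zeros-++ p m xs w i =
    trans (evl-++ p (zeros m) xs w i)
    (trans (cong₂ _+_ (evl-zeros p m w i)
             (cong (λ l → evl (p + + l) xs w i) (List.length-replicate m)))
           (ℤ.+-identityˡ (evl (p + + m) xs w i)))

  evl-++-zeros : ∀ p xs m w → evl p (xs ++ zeros m) w ≗ evl p xs w
  evl-++-zeros p xs m w i =
    trans (evl-++ p xs (zeros m) w i)
    (trans (cong (_+_ (evl p xs w i)) (evl-zeros (p + + length xs) m w i))
           (ℤ.+-identityʳ (evl p xs w i)))

  evl-mulList : ∀ p q xs ys w → evl (p + q) (mulList xs ys) w ≗ evl p xs (evl q ys w)
  evl-mulList p q []       ys w i = refl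
  evl-mulList p q (x ∷ xs) ys w i = begin
    evl (p + q) (addList (map (x *_) ys) (+ 0 ∷ mulList xs ys)) w i
      ≡⟨ evl-addList (p + q) (map (x *_) ys) (+ 0 ∷ mulList xs ys) w i ⟩
    evl (p + q) (map (x *_) ys) w i
      + (+ 0 * σ (p + q) w i + evl (+ 1 + (p + q)) (mulList xs ys) w i)
      ≡⟨ cong₂ _+_
           (trans (evl-map-* (p + q) x ys w i) (cong (x *_) (sym (σ-evl p q ys w i))))
           (trans (cong₂ _+_ (ℤ.*-zeroˡ (σ (p + q) w i))
                    (trans (cong (λ r → evl r (mulList xs ys) w i) (sym (ℤ.+-assoc (+ 1) p q)))
                           (evl-mulList (+ 1 + p) q xs ys w i)))
                  (ℤ.+-identityˡ _)) ⟩
    x * σ p (evl q ys w) i + evl (+ 1 + p) xs (evl q ys w) i ∎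
    where
    open ≡-Reasoning

  ev : Laurent → (I → ℤ) → I → ℤ
  ev P = evl (low P) (coeffs P)

  ev-+L : ∀ P P′ w → ev (P +L P′) w ≗ ev P w ⊕ ev P′ w
  ev-+L (laurent p xs) (laurent q ys) w i with p ℤ.≤? q
  ... | yes p≤q =
    trans (evl-addList p xs (zeros ∣ q - p ∣ ++ ys) w i)
    (cong (_+_ (evl p xs w i))
      (trans (evl-zeros-++ p ∣ q - p ∣ ys w i)
             (cong (λ r → evl r ys w i) (p+∣q-p∣ p q p≤q))))
  ... | no p≰q =
    trans (evl-addList q (zeros ∣ p - q ∣ ++ xs) ys w i)
    (cong (_+ evl q ys w i)
      (trans (evl-zeros-++ q ∣ p - q ∣ xs w i)
             (cong (λ r → evl r xs w i) (p+∣q-p∣ q p (ℤ.<⇒≤ (ℤ.≰⇒> p≰q))))))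

  ev-*L : ∀ P P′ w → ev (P *L P′) w ≗ ev P (ev P′ w)
  ev-*L (laurent p xs) (laurent q ys) = evl-mulList p q xs ys

  ev-negL : ∀ P w i → ev (negL P) w i ≡ - ev P w i
  ev-negL (laurent p xs) = evl-map-neg p xs

  ev-constL : ∀ c w → ev (constL c) w ≗ c ⊙ w
  ev-constL c w i = trans (ℤ.+-identityʳ (c * σ (+ 0) w i)) (cong (c *_) (σ-0 w i))

  ev-monoL : ∀ e w → ev (monoL e) w ≗ σ e w
  ev-monoL e w i = trans (ℤ.+-identityʳ (+ 1 * σ e w i)) (ℤ.*-identityˡ (σ e w i))

  ev-sumL : ∀ k P w → ev (sumL k P) w ≗ Σᵥ k (λ j → ev (P j) w)
  ev-sumL zero    P w i = refl
  ev-sumL (suc k) P w i =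
    trans (ev-+L (P F.zero) (sumL k (P ∘ F.suc)) w i)
          (cong (_+_ (ev (P F.zero) w i)) (ev-sumL k (P ∘ F.suc) w i))

  ev-normalize : ∀ P w → ev (normalize P) w ≗ ev P w
  ev-normalize (laurent p xs) w i =
    trans (sym (evl-++-zeros p′ ys m w i))
    (trans (cong (λ zs → evl p′ zs w i) (sym (trailZeros-split (dropZeros xs))))
    (trans (sym (evl-zeros-++ p (leadZeros xs) (dropZeros xs) w i))
           (cong (λ zs → evl p zs w i) (sym (leadZeros-split xs)))))
    where
    p′ : ℤ
    p′ = p + + leadZeros xs
    ys : List ℤ
    ys = reverse (dropZeros (reverse (dropZeros xs)))
    m : ℕ
    m = leadZeros (reverse (dropZeros xs))

  module _ (k : ℕ) (s : Fin k → ℕ) where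

    Q : (I → ℤ) → I → ℤ
    Q w = + (2 ℕ.* k ℕ.+ 2) ⊙ w ⊖ Σᵥ k (λ j → σ (+ s j) w ⊕ σ (- + s j) w)

    Q-linear : Linear Q
    Q-linear = ⊖-linear (⊙-linear (+ (2 ℕ.* k ℕ.+ 2)) id-linear)
      (Σ-linear k (λ j → ⊕-linear (σ-linear (+ s j)) (σ-linear (- + s j))))

    ev-baseL : ∀ w → ev (baseL k s) w ≗ Q w
    ev-baseL w i =
      trans (ev-+L (constL (+ (2 ℕ.* k ℕ.+ 2))) (negL S) w i)
      (cong₂ _+_ (ev-constL (+ (2 ℕ.* k ℕ.+ 2)) w i)
        (trans (ev-negL S w i)
          (cong -_ (trans (ev-sumL k P w i) (sum-cong k (λ j →
            trans (ev-+L (monoL (+ s j)) (monoL (- + s j)) w i)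
                  (cong₂ _+_ (ev-monoL (+ s j) w i) (ev-monoL (- + s j) w i))))))))
      where
      P : Fin k → Laurent
      P j = monoL (+ s j) +L monoL (- + s j)
      S : Laurent
      S = sumL k P

    ev-polyP : ∀ w → ev (polyP k s) w ≗ Q (Q w) ⊖ w
    ev-polyP w i =
      trans (ev-+L (baseL k s *L baseL k s) (negL (constL (+ 1))) w i)
      (cong₂ _+_
        (trans (ev-*L (baseL k s) (baseL k s) w i)
        (trans (≗-cong (evl-linear (low (baseL k s)) (coeffs (baseL k s))) (ev-baseL w) i)
               (ev-baseL (Q w) i)))
        (trans (ev-negL (constL (+ 1)) w i)
          (cong -_ (trans (ev-constL (+ 1) w i) (ℤ.*-identityˡ (w i))))))

-- Bimonicity

-- Evaluating a Laurent polynomial on δ₀ returns its coefficient function.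
shift : Action ℤ
shift = record
  { σ        = λ d w i → w (i - d)
  ; σ-linear = λ d → record
    { ≗-cong = λ p i → p (i - d) ; ⊕-homo = λ _ _ _ → refl ; ⊙-homo = λ _ _ _ → refl }
  ; σ-0      = λ w i → cong w (ℤ.+-identityʳ i)
  ; σ-+      = λ d e w i → cong w (eq d e i)
  }
  where
  eq : ∀ d e i → i - (d + e) ≡ i - d - e
  eq = solve-∀

δ₀ : ℤ → ℤ
δ₀ (+ zero)    = + 1
δ₀ (+ (suc _)) = + 0
δ₀ -[1+ _ ]    = + 0

module Coefficients where

  open Evaluation shift

  evl-below : ∀ p xs d → evl p xs δ₀ (p - + suc d) ≡ + 0
  evl-below p []       d = refl
  evl-below p (x ∷ xs) d = cong₂ _+_
    (trans (cong (λ i → x * δ₀ i) (e₁ p (+ suc d))) (ℤ.*-zeroʳ x))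
    (trans (cong (evl (+ 1 + p) xs δ₀) (e₂ p (+ suc d))) (evl-below (+ 1 + p) xs (suc d)))
    where
    e₁ : ∀ p d → p - d - p ≡ - d
    e₁ = solve-∀
    e₂ : ∀ p d → p - d ≡ + 1 + p - (+ 1 + d)
    e₂ = solve-∀

  evl-above : ∀ p xs d → evl p xs δ₀ (p + + length xs + + d) ≡ + 0
  evl-above p []       d = refl
  evl-above p (x ∷ xs) d = cong₂ _+_
    (trans (cong (λ i → x * δ₀ i) (e₁ p (+ length xs) (+ d))) (ℤ.*-zeroʳ x))
    (trans (cong (evl (+ 1 + p) xs δ₀) (e₂ p (+ length xs) (+ d))) (evl-above (+ 1 + p) xs d))
    where
    e₁ : ∀ p l d → p + (+ 1 + l) + d - p ≡ + 1 + (l + d)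
    e₁ = solve-∀
    e₂ : ∀ p l d → p + (+ 1 + l) + d ≡ + 1 + p + l + d
    e₂ = solve-∀

  evl-first : ∀ p x xs → evl p (x ∷ xs) δ₀ p ≡ x
  evl-first p x xs = trans (cong₂ _+_
    (trans (cong (λ i → x * δ₀ i) (ℤ.+-inverseʳ p)) (ℤ.*-identityʳ x))
    (trans (cong (evl (+ 1 + p) xs δ₀) (e p)) (evl-below (+ 1 + p) xs 0)))
    (ℤ.+-identityʳ x)
    where
    e : ∀ p → p ≡ + 1 + p - + 1
    e = solve-∀

  evl-last : ∀ p xs x → evl p (xs ++ x ∷ []) δ₀ (p + + length xs) ≡ x
  evl-last p xs x =
    trans (evl-++ p xs (x ∷ []) δ₀ (p + + length xs))
    (trans (cong₂ _+_
      (trans (cong (evl p xs δ₀) (sym (ℤ.+-identityʳ (p + + length xs)))) (evl-above p xs 0))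
      (evl-first (p + + length xs) x []))
    (ℤ.+-identityˡ x))

  Vanishes-above : (ℤ → ℤ) → ℤ → Set
  Vanishes-above w b = ∀ d → w (b + + suc d) ≡ + 0

  Even : (ℤ → ℤ) → Set
  Even w = ∀ i → w (- i) ≡ w i

  trichotomy : ∀ a b → (a ≡ b) ⊎ (∃ λ d → a ≡ b + + suc d) ⊎ (∃ λ d → b ≡ a + + suc d)
  trichotomy a b with a - b in eq
  ... | + zero    = inj₁ (ℤ.i-j≡0⇒i≡j a b eq)
  ... | + suc d   = inj₂ (inj₁ (d , trans (e a b) (cong (_+_ b) eq)))
    where
    e : ∀ a b → a ≡ b + (a - b)
    e = solve-∀
  ... | -[1+ d ]  = inj₂ (inj₂ (d , trans (e a b) (cong (λ c → a + - c) eq)))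
    where
    e : ∀ a b → b ≡ a + - (a - b)
    e = solve-∀

  top-position : ∀ {w a b} → Vanishes-above w a → Vanishes-above w b →
                 w a ≢ + 0 → w b ≢ + 0 → a ≡ b
  top-position {w} {a} {b} va vb wa wb with trichotomy a b
  ... | inj₁ a≡b              = a≡b
  ... | inj₂ (inj₁ (d , a≡))  = ⊥-elim (wa (trans (cong w a≡) (vb d)))
  ... | inj₂ (inj₂ (d , b≡))  = ⊥-elim (wb (trans (cong w b≡) (va d)))

  -- The first entry is nonzero and sits at `p`, below which everything vanishes. By evenness -`p`
  -- is then the position of the top coefficient, so -`p` = `suc D` and the first entry is 1. The
  -- last nonzero entry sits at the same top position and is 1 as well.
  bimonic-list : ∀ p xs D → Vanishes-above (evl p xs δ₀) (+ suc D) →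
                 evl p xs δ₀ (+ suc D) ≡ + 1 → Even (evl p xs δ₀) →
                 ∀ {y r t z} → xs ≡ y ∷ r → y ≢ + 0 → xs ≡ t ++ z ∷ [] → z ≢ + 0 →
                 ∃ λ mid → xs ≡ + 1 ∷ mid ++ + 1 ∷ []
  bimonic-list p xs D above top even {y} {r} {t} {z} xs≡y∷r y≢0 xs≡t∷z z≢0 =
    result t xs≡t∷z t-position
    where
    c : ℤ → ℤ
    c = evl p xs δ₀
    first : c p ≡ y
    first = trans (cong (λ l → evl p l δ₀ p) xs≡y∷r) (evl-first p y r)
    last : c (p + + length t) ≡ z
    last = trans (cong (λ l → evl p l δ₀ (p + + length t)) xs≡t∷z) (evl-last p t z)
    c-top : c (+ suc D) ≢ + 0
    c-top q with trans (sym top) q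
    ... | ()
    e₁ : ∀ p d → - p + d ≡ - (p - d)
    e₁ = solve-∀
    p-position : - p ≡ + suc D
    p-position = top-position {c}
      (λ d → trans (cong c (e₁ p (+ suc d))) (trans (even (p - + suc d)) (evl-below p xs d)))
      above (λ q → y≢0 (trans (sym first) (trans (sym (even p)) q))) c-top
    e₂ : ∀ p l d → p + l + (+ 1 + d) ≡ p + (l + + 1) + d
    e₂ = solve-∀
    len : + length xs ≡ + length t + + 1
    len = cong +_ (trans (cong length xs≡t∷z) (List.length-++ t))
    t-position : p + + length t ≡ + suc D
    t-position = top-position {c}
      (λ d → trans (cong c (trans (e₂ p (+ length t) (+ d)) (cong (λ l → p + l + + d) (sym len))))
                   (evl-above p xs d))
      above (λ q → z≢0 (trans (sym last) q)) c-top
    y≡1 : y ≡ + 1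
    y≡1 = trans (sym first) (trans (sym (even p)) (trans (cong c p-position) top))
    z≡1 : p + + length t ≡ + suc D → z ≡ + 1
    z≡1 q = trans (sym last) (trans (cong c q) top)
    result : ∀ u → xs ≡ u ++ z ∷ [] → p + + length u ≡ + suc D →
             ∃ λ mid → xs ≡ + 1 ∷ mid ++ + 1 ∷ []
    -- A single entry would be first and last at once, forcing `p` = -`p` = `suc D`; positivity of
    -- `suc D` excludes this.
    result [] _ q with trans (sym p-position) (cong -_ (trans (sym (ℤ.+-identityʳ p)) q))
    ... | ()
    result (u ∷ us) xs≡ _ = us ,
      trans xs≡ (cong₂ (λ a b → a ∷ us ++ b ∷ [])
                       (trans (List.∷-injectiveˡ (trans (sym xs≡) xs≡y∷r)) y≡1)
                       (z≡1 t-position))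

  dropZeros-head : ∀ xs → dropZeros xs ≡ [] ⊎ ∃ λ y → ∃ λ r → dropZeros xs ≡ y ∷ r × y ≢ + 0
  dropZeros-head []       = inj₁ refl
  dropZeros-head (x ∷ xs) with x ℤ.≟ + 0
  ... | yes _  = dropZeros-head xs
  ... | no x≢0 = inj₂ (x , xs , refl , x≢0)

  -- Stripping trailing zeros leaves a prefix of `dropZeros xs`. A nonempty prefix has the same
  -- head, and that head is nonzero because leading zeros are gone.
  normalize-head : ∀ xs {y r} → reverse (dropZeros (reverse (dropZeros xs))) ≡ y ∷ r → y ≢ + 0
  normalize-head xs {y} {r} eq with dropZeros-head xs | trans (trailZeros-split (dropZeros xs))
    (cong (_++ zeros (leadZeros (reverse (dropZeros xs)))) eq)
  ... | inj₁ d≡[]              | q with trans (sym d≡[]) q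
  ...   | ()
  normalize-head xs {y} {r} eq | inj₂ (y′ , r′ , d≡ , y′≢0) | q =
    λ y≡0 → y′≢0 (trans (List.∷-injectiveˡ (trans (sym d≡) q)) y≡0)

  normalize-last : ∀ ys → reverse (dropZeros ys) ≡ [] ⊎
                   ∃ λ t → ∃ λ z → reverse (dropZeros ys) ≡ t ++ z ∷ [] × z ≢ + 0
  normalize-last ys with dropZeros-head ys
  ... | inj₁ d≡[]               = inj₁ (cong reverse d≡[])
  ... | inj₂ (z , t , d≡ , z≢0) =
    inj₂ (reverse t , z , trans (cong reverse d≡) (List.unfold-reverse z t) , z≢0)

  bimonic : ∀ P D → Vanishes-above (ev P δ₀) (+ suc D) → ev P δ₀ (+ suc D) ≡ + 1 →
            Even (ev P δ₀) → Bimonic P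
  bimonic P D above top even = result (coeffs N) refl (normalize-last (reverse (dropZeros (coeffs P))))
    where
    N : Laurent
    N = normalize P
    top′ : ev N δ₀ (+ suc D) ≡ + 1
    top′ = trans (ev-normalize P δ₀ (+ suc D)) top
    result : ∀ xs → coeffs N ≡ xs →
      coeffs N ≡ [] ⊎ (∃ λ t → ∃ λ z → coeffs N ≡ t ++ z ∷ [] × z ≢ + 0) → Bimonic P
    -- An empty coefficient list evaluates to zero, against the top coefficient 1.
    result [] eq _ with trans (sym (cong (λ l → evl (low N) l δ₀ (+ suc D)) eq)) top′
    ... | ()
    result (y ∷ r) eq (inj₁ eq′) with trans (sym eq) eq′
    ... | ()
    result (y ∷ r) eq (inj₂ (t , z , eq′ , z≢0)) =
      bimonic-list (low N) (coeffs N) D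
        (λ d → trans (ev-normalize P δ₀ (+ suc D + + suc d)) (above d)) top′
        (λ i → trans (ev-normalize P δ₀ (- i)) (trans (even i) (sym (ev-normalize P δ₀ i))))
        eq (normalize-head (coeffs P) eq) eq′ z≢0

  module _ (k : ℕ) (s : Fin k → ℕ) where

    Q-even : ∀ {w} → Even w → Even (Q k s w)
    Q-even {w} even i = cong₂ (λ a b → + (2 ℕ.* k ℕ.+ 2) * a - b) (even i)
      (sum-cong k (λ j → trans
        (cong₂ _+_ (trans (cong w (e₁ i (+ s j))) (even (i - - + s j)))
                   (trans (cong w (e₂ i (+ s j))) (even (i - + s j))))
        (ℤ.+-comm (w (i - - + s j)) (w (i - + s j)))))
      where
      e₁ : ∀ i s → - i - s ≡ - (i - - s)
      e₁ = solve-∀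
      e₂ : ∀ i s → - i - - s ≡ - (i - s)
      e₂ = solve-∀

    module _ (l : Fin k) (max : ∀ j → j ≢ l → s j < s l) where

      max-≤ : ∀ j → s j ≤ s l
      max-≤ j with j F.≟ l
      ... | yes refl = ℕ.≤-refl
      ... | no  j≢l  = ℕ.<⇒≤ (max j j≢l)

      right-zero : ∀ {w b} → Vanishes-above w b → ∀ d s → w (b + + suc d - - + s) ≡ + 0
      right-zero {w} {b} v d s = trans (cong w (e b (+ d) (+ s))) (v (d ℕ.+ s))
        where
        e : ∀ b d s → b + (+ 1 + d) - - s ≡ b + (+ 1 + (d + s))
        e = solve-∀

      Q-vanishes : ∀ {w b} → Vanishes-above w b → Vanishes-above (Q k s w) (b + + s l)
      Q-vanishes {w} {b} v d = cong₂ (λ a b → a - b)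
        (trans (cong (λ i → + (2 ℕ.* k ℕ.+ 2) * w i) (e₀ b (+ s l) (+ d)))
          (trans (cong (_*_ (+ (2 ℕ.* k ℕ.+ 2))) (v (s l ℕ.+ d))) (ℤ.*-zeroʳ (+ (2 ℕ.* k ℕ.+ 2)))))
        (sum-0 k (λ j → cong₂ _+_ (left j)
          (trans (cong (λ i → w (i - - + s j)) (e₀ b (+ s l) (+ d))) (right-zero {w} {b} v (s l ℕ.+ d) (s j)))))
        where
        e₀ : ∀ b l d → b + l + (+ 1 + d) ≡ b + (+ 1 + (l + d))
        e₀ = solve-∀
        e₁ : ∀ b s r d → b + (s + r) + (+ 1 + d) - s ≡ b + (+ 1 + (r + d))
        e₁ = solve-∀
        left : ∀ j → w (b + + s l + + suc d - + s j) ≡ + 0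
        left j = trans
          (cong (λ t → w (b + + t + + suc d - + s j)) (sym (ℕ.m+[n∸m]≡n (max-≤ j))))
          (trans (cong w (e₁ b (+ s j) (+ (s l ℕ.∸ s j)) (+ d))) (v (s l ℕ.∸ s j ℕ.+ d)))

      -- At position `b + s l` every term of q reads `w` strictly above `b`, except the shift by the
      -- largest jump, which reads `w b` and carries the sign -. Two applications therefore turn δ₀
      -- into a function with leading coefficient +1.
      Q-leading : 1 ≤ s l → ∀ {w b} → Vanishes-above w b → Q k s w (b + + s l) ≡ - w b
      Q-leading 1≤sl {w} {b} v = trans
        (cong₂ (λ a b → a - b)
          (trans (cong (λ i → + (2 ℕ.* k ℕ.+ 2) * w i) sl)
            (trans (cong (_*_ (+ (2 ℕ.* k ℕ.+ 2))) (v s′)) (ℤ.*-zeroʳ (+ (2 ℕ.* k ℕ.+ 2)))))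
          (trans (sum-cong k term) (sum-δ k (λ _ → w b) l)))
        (ℤ.+-identityˡ (- w b))
        where
        s′ : ℕ
        s′ = s l ℕ.∸ 1
        sl : b + + s l ≡ b + + suc s′
        sl = cong (λ t → b + + t) (sym (ℕ.m+[n∸m]≡n 1≤sl))
        e₁ : ∀ b t → b + t - t ≡ b
        e₁ = solve-∀
        e₂ : ∀ b s r → b + (s + r) - s ≡ b + r
        e₂ = solve-∀
        left : ∀ j → w (b + + s l - + s j) ≡ δ (toℕ j) (toℕ l) * w b
        left j with j F.≟ l
        ... | yes refl = trans (cong w (e₁ b (+ s j)))
          (sym (trans (cong (_* w b) (δ-refl (toℕ j))) (ℤ.*-identityˡ (w b))))
        ... | no j≢l = trans
          (trans (cong (λ t → w (b + + t - + s j)) (sym (ℕ.m+[n∸m]≡n (max-≤ j))))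
          (trans (cong w (e₂ b (+ s j) (+ (s l ℕ.∸ s j))))
          (trans (cong (λ t → w (b + + t)) (sym (ℕ.m+[n∸m]≡n (ℕ.m<n⇒0<n∸m (max j j≢l)))))
                 (v (s l ℕ.∸ s j ℕ.∸ 1)))))
          (sym (trans (cong (_* w b) (δ-≢ (j≢l ∘ F.toℕ-injective))) (ℤ.*-zeroˡ (w b))))
        term : ∀ j → w (b + + s l - + s j) + w (b + + s l - - + s j) ≡ δ (toℕ j) (toℕ l) * w b
        term j = trans (cong₂ _+_ (left j)
          (trans (cong (λ i → w (i - - + s j)) sl) (right-zero {w} {b} v s′ (s j))))
          (ℤ.+-identityʳ _)

      polyP-bimonic : 1 ≤ s l → Bimonic (polyP k s)
      polyP-bimonic 1≤sl = bimonic (polyP k s) D above top even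
        where
        D : ℕ
        -- `suc D` is the degree 2 `s l` of q². It is positive, so the summand -1 of q² - 1 does not
        -- reach the top coefficient and appears below as `- + 0`.
        D = (s l ℕ.+ s l) ℕ.∸ 1
        D-suc : + 0 + + s l + + s l ≡ + suc D
        D-suc = cong +_ (sym (ℕ.m+[n∸m]≡n (ℕ.≤-trans 1≤sl (ℕ.m≤m+n (s l) (s l)))))
        q : (ℤ → ℤ) → ℤ → ℤ
        q = Q k s
        δ₀-vanishes : Vanishes-above δ₀ (+ 0)
        δ₀-vanishes d = refl
        q-vanishes : Vanishes-above (q δ₀) (+ 0 + + s l)
        q-vanishes = Q-vanishes {δ₀} {+ 0} δ₀-vanishes
        δ₀-even : Even δ₀
        δ₀-even (+ zero)  = refl
        δ₀-even (+ suc _) = refl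
        δ₀-even -[1+ _ ]  = refl
        coefficient : ∀ i → ev (polyP k s) δ₀ i ≡ q (q δ₀) i - δ₀ i
        coefficient = ev-polyP k s δ₀
        above : Vanishes-above (ev (polyP k s) δ₀) (+ suc D)
        above d = trans (coefficient (+ suc D + + suc d))
          (cong (λ a → a - + 0) (trans (cong (λ i → q (q δ₀) (i + + suc d)) (sym D-suc))
            (Q-vanishes {q δ₀} {+ 0 + + s l} q-vanishes d)))
        top : ev (polyP k s) δ₀ (+ suc D) ≡ + 1
        top = trans (coefficient (+ suc D))
          (cong (λ a → a - + 0) (trans (cong (q (q δ₀)) (sym D-suc))
            (trans (Q-leading 1≤sl {q δ₀} {+ 0 + + s l} q-vanishes)
                   (cong -_ (Q-leading 1≤sl {δ₀} {+ 0} δ₀-vanishes)))))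
        even : Even (ev (polyP k s) δ₀)
        even i = trans (coefficient (- i))
          (trans (cong₂ _-_ (Q-even (Q-even δ₀-even) i) (δ₀-even i)) (sym (coefficient i)))

-- Modules on which zⁿ acts as q(z), and the maps between them

ℤ-induction : (P : ℤ → Set) → P (+ 0) → (∀ d → P d → P (+ 1 + d)) →
              (∀ d → P (+ 1 + d) → P d) → ∀ d → P d
ℤ-induction P base up down (+ zero)      = base
ℤ-induction P base up down (+ suc d)     = up (+ d) (ℤ-induction P base up down (+ d))
ℤ-induction P base up down -[1+ zero ]   = down -[1+ 0 ] base
ℤ-induction P base up down -[1+ suc d ]  = down -[1+ suc d ] (ℤ-induction P base up down -[1+ d ])

-- The second alternative is an index past the end, where `nth` returns its default 0. Thanks to it
-- `horner-step` holds for every index.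
drop-step : ∀ (xs : List ℤ) i → (drop i xs ≡ nth xs i ∷ drop (suc i) xs) ⊎
                                (drop i xs ≡ [] × nth xs i ≡ + 0 × drop (suc i) xs ≡ [])
drop-step []       i       = inj₂ (List.drop-[] i , refl , refl)
drop-step (x ∷ xs) zero    = inj₁ refl
drop-step (x ∷ xs) (suc i) = drop-step xs i

module Residues (k n : ℕ) (s : Fin k → ℕ) {I : Set} (𝒳 : Action I) where

  open Action 𝒳 public
  open Evaluation 𝒳 public hiding (Q; Q-linear; ev-baseL; ev-polyP)

  Q : (I → ℤ) → I → ℤ
  Q = Evaluation.Q 𝒳 k s

  Q-linear : Linear Q
  Q-linear = Evaluation.Q-linear 𝒳 k s

  M : (I → ℤ) → I → ℤ
  M w = σ (+ n) w ⊖ Q w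

  M-linear : Linear M
  M-linear = ⊖-linear (σ-linear (+ n)) Q-linear

  open Quotient M-linear public

  σ-Q : ∀ d w → σ d (Q w) ≗ Q (σ d w)
  σ-Q d w i = trans (⊖-homo L (c ⊙ w) (Σᵥ k t) i)
    (cong₂ _-_ (⊙-homo L c w i)
      (trans (Σ-homo L k t i) (sum-cong k (λ j →
        trans (⊕-homo L (σ (+ s j) w) (σ (- + s j) w) i)
              (cong₂ _+_ (σ-comm d (+ s j) w i) (σ-comm d (- + s j) w i))))))
    where
    L : Linear (σ d)
    L = σ-linear d
    c : ℤ
    c = + (2 ℕ.* k ℕ.+ 2)
    t : Fin k → I → ℤ
    t j = σ (+ s j) w ⊕ σ (- + s j) w

  -- `M` is itself a polynomial in z and commutes with `σ d`, so im `M` is a submodule; the new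
  -- preimage is `σ d` of the old one.
  σ-cong : ∀ d {x y} → x ∼ y → σ d x ∼ σ d y
  σ-cong d {x} {y} (w , p) = σ d w , λ i →
    trans (cong₂ _-_ (σ-comm (+ n) d w i) (sym (σ-Q d w i)))
    (trans (sym (⊖-homo (σ-linear d) (σ (+ n) w) (Q w) i))
    (trans (≗-cong (σ-linear d) p i) (⊖-homo (σ-linear d) x y i)))

  σn∼Q : ∀ w → σ (+ n) w ∼ Q w
  σn∼Q w = w , λ _ → refl

  σnσn∼QQ : ∀ w → σ (+ n) (σ (+ n) w) ∼ Q (Q w)
  σnσn∼QQ w = ∼-trans (σ-cong (+ n) (σn∼Q w)) (σn∼Q (Q w))

  cs : List ℤ
  cs = coeffs (normalize (polyP k s))

  lowest : ℤ
  lowest = low (normalize (polyP k s))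

  evl-cs : ∀ w → evl lowest cs w ≗ Q (Q w) ⊖ w
  evl-cs w i = trans (ev-normalize (polyP k s) w i) (Evaluation.ev-polyP 𝒳 k s w i)

  horner : ℕ → (I → ℤ) → I → ℤ
  horner j = evl (+ 0) (drop j cs)

  horner-step : ∀ j w → horner j w ≗ nth cs j ⊙ w ⊕ σ (+ 1) (horner (suc j) w)
  horner-step j w i with drop-step cs j
  ... | inj₁ q = trans (cong (λ l → evl (+ 0) l w i) q)
    (cong₂ _+_ (cong (nth cs j *_) (σ-0 w i)) (sym (σ-evl (+ 1) (+ 0) (drop (suc j) cs) w i)))
  ... | inj₂ (q , r , q′) = trans (cong (λ l → evl (+ 0) l w i) q)
    (sym (cong₂ _+_ (trans (cong (_* w i) r) (ℤ.*-zeroˡ (w i)))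
      (trans (σ-evl (+ 1) (+ 0) (drop (suc j) cs) w i) (cong (λ l → evl (+ 1) l w i) q′))))

  horner-end : ∀ j → length cs ≤ j → ∀ w → horner j w ≗ 𝟎
  horner-end j p w i = cong (λ l → evl (+ 0) l w i) (List.drop-all j cs p)

  σ-horner₀ : ∀ w → σ lowest (horner 0 w) ≗ Q (Q w) ⊖ w
  σ-horner₀ w i = trans (σ-evl lowest (+ 0) cs w i)
    (trans (cong (λ p → evl p cs w i) (ℤ.+-identityʳ lowest)) (evl-cs w i))

  -- Up to the invertible factor `σ lowest`, `horner 0 w` is q²`w` - `w`. Modulo im `M` q² acts as
  -- z^{2n}, which fixes `w`.
  horner₀-zero : ∀ w → σ (+ n) (σ (+ n) w) ≗ w → horner 0 w ∼ 𝟎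
  horner₀-zero w p = ∼-trans
    (≗⇒∼ (λ i → sym (σ-inverse (ℤ.+-inverseˡ lowest) (horner 0 w) i)))
    (∼-trans (σ-cong (- lowest) (∼-trans (≗⇒∼ (σ-horner₀ w))
      (∼-trans (⊖-cong (∼-sym (σnσn∼QQ w)) (∼-refl w))
               (≗⇒∼ (λ i → ℤ.i≡j⇒i-j≡0 (p i))))))
    (≗⇒∼ (𝟎-homo (σ-linear (- lowest)))))

  -- The converse exchange: here the polynomial relation is exact and the periodicity comes out
  -- modulo im `M`.
  σnσn-fixed : ∀ w → horner 0 w ≗ 𝟎 → σ (+ n) (σ (+ n) w) ∼ w
  σnσn-fixed w p = ∼-trans (σnσn∼QQ w) (≗⇒∼ (λ i → ℤ.i-j≡0⇒i≡j (Q (Q w) i) (w i)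
    (trans (sym (σ-horner₀ w i)) (trans (≗-cong (σ-linear lowest) p i) (𝟎-homo (σ-linear lowest) i)))))

module Intertwining (k n : ℕ) (s : Fin k → ℕ) {I J : Set} (𝒳 : Action I) (𝒴 : Action J)
  {F : (I → ℤ) → (J → ℤ)} (FL : Linear F) where

  private
    module X = Residues k n s 𝒳
    module Y = Residues k n s 𝒴

  module _ (F-σ₁ : ∀ x → F (X.σ (+ 1) x) Y.∼ Y.σ (+ 1) (F x)) where

    -- Commutation with z extends to z⁻¹ by cancelling: a forward step is inserted together with
    -- `Y.σ (- + 1)`, which preserves the congruence, and the forward step is then moved through
    -- `F`.
    F-σ : ∀ d x → F (X.σ d x) Y.∼ Y.σ d (F x)
    F-σ = ℤ-induction (λ d → ∀ x → F (X.σ d x) Y.∼ Y.σ d (F x)) base up down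
      where
      base : ∀ x → F (X.σ (+ 0) x) Y.∼ Y.σ (+ 0) (F x)
      base x = Y.≗⇒∼ (λ i → trans (≗-cong FL (X.σ-0 x) i) (sym (Y.σ-0 (F x) i)))
      up : ∀ d → (∀ x → F (X.σ d x) Y.∼ Y.σ d (F x)) → ∀ x → F (X.σ (+ 1 + d) x) Y.∼ Y.σ (+ 1 + d) (F x)
      up d ih x = Y.∼-trans (Y.≗⇒∼ (≗-cong FL (X.σ-+ (+ 1) d x)))
        (Y.∼-trans (F-σ₁ (X.σ d x))
        (Y.∼-trans (Y.σ-cong (+ 1) (ih x)) (Y.≗⇒∼ (λ i → sym (Y.σ-+ (+ 1) d (F x) i)))))
      e : ∀ d → - + 1 + (+ 1 + d) ≡ d
      e = solve-∀
      cancel : ∀ d y → Y.σ (- + 1) (Y.σ (+ 1 + d) y) ≗ Y.σ d y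
      cancel d y i = trans (sym (Y.σ-+ (- + 1) (+ 1 + d) y i)) (cong (λ c → Y.σ c y i) (e d))
      down : ∀ d → (∀ x → F (X.σ (+ 1 + d) x) Y.∼ Y.σ (+ 1 + d) (F x)) → ∀ x → F (X.σ d x) Y.∼ Y.σ d (F x)
      down d ih x = Y.∼-trans
        (Y.≗⇒∼ (λ i → sym (Y.σ-inverse { - + 1} {+ 1} refl (F (X.σ d x)) i)))
        (Y.∼-trans (Y.σ-cong (- + 1) (Y.∼-trans (Y.∼-sym (F-σ₁ (X.σ d x)))
          (Y.∼-trans (Y.≗⇒∼ (≗-cong FL (λ i → sym (X.σ-+ (+ 1) d x i)))) (ih x))))
        (Y.≗⇒∼ (cancel d (F x))))

    F-evl : ∀ p xs x → F (X.evl p xs x) Y.∼ Y.evl p xs (F x)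
    F-evl p []       x = Y.≗⇒∼ (𝟎-homo FL)
    F-evl p (a ∷ xs) x = Y.∼-trans (Y.≗⇒∼ (⊕-homo FL (a ⊙ X.σ p x) (X.evl (+ 1 + p) xs x)))
      (Y.⊕-cong (Y.∼-trans (Y.≗⇒∼ (⊙-homo FL a (X.σ p x))) (Y.⊙-cong a (F-σ p x)))
                (F-evl (+ 1 + p) xs x))

    F-Q : ∀ x → F (X.Q x) Y.∼ Y.Q (F x)
    F-Q x = Y.∼-trans (Y.≗⇒∼ (⊖-homo FL (c ⊙ x) (Σᵥ k t)))
      (Y.⊖-cong (Y.≗⇒∼ (⊙-homo FL c x))
        (Y.∼-trans (Y.≗⇒∼ (Σ-homo FL k t))
          (Y.Σ-cong k (λ j → Y.∼-trans (Y.≗⇒∼ (⊕-homo FL (X.σ (+ s j) x) (X.σ (- + s j) x)))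
            (Y.⊕-cong (F-σ (+ s j) x) (F-σ (- + s j) x))))))
      where
      c : ℤ
      c = + (2 ℕ.* k ℕ.+ 2)
      t : Fin k → _
      t j = X.σ (+ s j) x ⊕ X.σ (- + s j) x

    -- This makes `F` well defined on the quotients: `F` carries zⁿ - q(z) to the same expression on
    -- the target, where zⁿ and q(z) agree.
    F-M : ∀ x → F (X.M x) Y.∼ 𝟎
    F-M x = Y.∼-trans (Y.≗⇒∼ (⊖-homo FL (X.σ (+ n) x) (X.Q x)))
      (Y.∼-trans (Y.⊖-cong (Y.∼-trans (F-σ (+ n) x) (Y.σn∼Q (F x))) (F-Q x))
                 (Y.≗⇒∼ (λ i → ℤ.+-inverseʳ (Y.Q (F x) i))))

    F-cong : ∀ {x y} → x X.∼ y → F x Y.∼ F y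
    F-cong {x} {y} (w X., p) = Y.∼-trans
      (Y.≗⇒∼ (λ i → trans (e (F x i) (F y i)) (cong (_+_ (F y i))
        (trans (sym (⊖-homo FL x y i)) (sym (≗-cong FL p i))))))
      (Y.∼-trans (Y.⊕-cong (Y.∼-refl (F y)) (F-M w))
                 (Y.≗⇒∼ (λ i → ℤ.+-identityʳ (F y i))))
      where
      e : ∀ a b → a ≡ b + (a - b)
      e = solve-∀

-- The companion matrix

module Powers {F G : (I → ℤ) → (I → ℤ)} (FL : Linear F) (GL : Linear G)
  (FG : ∀ x → F (G x) ≗ x) (GF : ∀ x → G (F x) ≗ x) where

  pow : ℤ → (I → ℤ) → I → ℤ
  pow (+ zero)     w = w
  pow (+ suc e)    w = F (pow (+ e) w)
  pow -[1+ zero ]  w = G w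
  pow -[1+ suc e ] w = G (pow -[1+ e ] w)

  pow-suc : ∀ d w → pow (+ 1 + d) w ≗ F (pow d w)
  pow-suc (+ e)        w i = refl
  pow-suc -[1+ zero ]  w i = sym (FG w i)
  pow-suc -[1+ suc e ] w i = sym (FG (pow -[1+ e ] w) i)

  pow-linear : ∀ d → Linear (pow d)
  pow-linear (+ zero)     = id-linear
  pow-linear (+ suc e)    = ∘-linear FL (pow-linear (+ e))
  pow-linear -[1+ zero ]  = GL
  pow-linear -[1+ suc e ] = ∘-linear GL (pow-linear -[1+ e ])

  pow-+ : ∀ d e w → pow (d + e) w ≗ pow d (pow e w)
  pow-+ = ℤ-induction (λ d → ∀ e w → pow (d + e) w ≗ pow d (pow e w)) base up down
    where
    base : ∀ e w → pow (+ 0 + e) w ≗ pow e w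
    base e w i = cong (λ c → pow c w i) (ℤ.+-identityˡ e)
    shifted : ∀ d e w → pow (+ 1 + d + e) w ≗ F (pow (d + e) w)
    shifted d e w i =
      trans (cong (λ c → pow c w i) (ℤ.+-assoc (+ 1) d e)) (pow-suc (d + e) w i)
    up : ∀ d → (∀ e w → pow (d + e) w ≗ pow d (pow e w)) →
         ∀ e w → pow (+ 1 + d + e) w ≗ pow (+ 1 + d) (pow e w)
    up d ih e w i = trans (shifted d e w i)
      (trans (≗-cong FL (ih e w) i) (sym (pow-suc d (pow e w) i)))
    down : ∀ d → (∀ e w → pow (+ 1 + d + e) w ≗ pow (+ 1 + d) (pow e w)) →
           ∀ e w → pow (d + e) w ≗ pow d (pow e w)
    down d ih e w i = trans (sym (GF (pow (d + e) w) i))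
      (trans (≗-cong GL (λ j → trans (sym (shifted d e w j))
                           (trans (ih e w j) (pow-suc d (pow e w) j))) i)
             (GF (pow d (pow e w)) i))

  powers : Action I
  powers = record { σ = pow ; σ-linear = pow-linear ; σ-0 = λ _ _ → refl ; σ-+ = pow-+ }

module _ {m : ℕ} where

  Iₘ-δ : ∀ (i j : Fin m) → Iₘ i j ≡ δ (toℕ i) (toℕ j)
  Iₘ-δ i j with i F.≟ j
  ... | yes refl = sym (δ-refl (toℕ i))
  ... | no  i≢j  = sym (δ-≢ (i≢j ∘ F.toℕ-injective))

  Iₘ-·ᵥ : ∀ (w : Vector m) → Iₘ ·ᵥ w ≗ w
  Iₘ-·ᵥ w i = trans (sum-cong m (λ j → cong (_* w j) (trans (Iₘ-δ i j) (δ-sym (toℕ i) (toℕ j)))))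
                    (sum-δ m w i)

  ·ₘ-·ᵥ : ∀ (M N : Matrix m) w → (M ·ₘ N) ·ᵥ w ≗ M ·ᵥ (N ·ᵥ w)
  ·ₘ-·ᵥ M N w i = begin
    sumℤ m (λ j → sumℤ m (λ l → M i l * N l j) * w j)
      ≡⟨ sum-cong m (λ j → trans (ℤ.*-comm (sumℤ m (λ l → M i l * N l j)) (w j))
           (sym (sum-* m (w j) (λ l → M i l * N l j)))) ⟩
    sumℤ m (λ j → sumℤ m (λ l → w j * (M i l * N l j)))
      ≡⟨ sum-swap m m (λ j l → w j * (M i l * N l j)) ⟩
    sumℤ m (λ l → sumℤ m (λ j → w j * (M i l * N l j)))
      ≡⟨ sum-cong m (λ l → trans (sum-cong m (λ j → e (w j) (M i l) (N l j)))
           (sum-* m (M i l) (λ j → N l j * w j))) ⟩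
    sumℤ m (λ l → M i l * sumℤ m (λ j → N l j * w j)) ∎
    where
    open ≡-Reasoning
    e : ∀ a b c → a * (b * c) ≡ b * (c * a)
    e = solve-∀

  ·ᵥ-basis : ∀ (M : Matrix m) l i → (M ·ᵥ basis l) i ≡ M i l
  ·ᵥ-basis M l i = trans (sum-cong m (λ j → ℤ.*-comm (M i j) (δ (toℕ j) (toℕ l))))
                         (sum-δ m (M i) l)

sum-δ-ℕ : ∀ {m l} → l < m → ∀ (g : ℕ → ℤ) → sumℤ m (λ i → δ (toℕ i) l * g (toℕ i)) ≡ g l
sum-δ-ℕ {m} {l} l<m g =
  subst (λ t → sumℤ m (λ i → δ (toℕ i) t * g (toℕ i)) ≡ g t) (F.toℕ-fromℕ< l<m)
        (sum-δ m (g ∘ toℕ) (F.fromℕ< l<m))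

-- One formula for the three cases of the definition: `δ (suc i) (span P)` is the indicator of the
-- last row, and in that row the superdiagonal term vanishes because `j` stays below `span P`.
companion-entry : ∀ P i j → companion P i j ≡
  δ (suc (toℕ i)) (toℕ j) - δ (suc (toℕ i)) (span P) * nth (coeffs (normalize P)) (toℕ j)
companion-entry P i j with suc (toℕ i) ℕ.<? span P
... | yes i<m with toℕ j ℕ.≟ suc (toℕ i)
...   | yes j≡ = sym (cong₂ (λ a b → a - b * nth (coeffs (normalize P)) (toℕ j))
          (trans (cong (δ (suc (toℕ i))) j≡) (δ-refl (suc (toℕ i)))) (δ-≢ (ℕ.<⇒≢ i<m)))
...   | no  j≢ = sym (cong₂ (λ a b → a - b * nth (coeffs (normalize P)) (toℕ j))
          (δ-≢ (j≢ ∘ sym)) (δ-≢ (ℕ.<⇒≢ i<m)))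
companion-entry P i j | no i≮m =
  sym (trans (cong₂ (λ a b → a - b * a_j) (δ-≢ (ℕ.>⇒≢ j<si))
               (trans (cong (δ (suc (toℕ i))) (sym i≡)) (δ-refl (suc (toℕ i)))))
      (trans (cong (λ a → + 0 - a) (ℤ.*-identityˡ a_j)) (ℤ.+-identityˡ (- a_j))))
  where
  a_j : ℤ
  a_j = nth (coeffs (normalize P)) (toℕ j)
  i≡ : suc (toℕ i) ≡ span P
  i≡ = ℕ.≤-antisym (F.toℕ<n i) (ℕ.≮⇒≥ i≮m)
  j<si : toℕ j < suc (toℕ i)
  j<si = subst (toℕ j <_) (sym i≡) (F.toℕ<n j)

nth-last : ∀ xs x → nth (xs ++ x ∷ []) (length xs) ≡ x
nth-last []       x = refl
nth-last (_ ∷ xs) x = nth-last xs x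

module Companion (P : Laurent) (bim : Bimonic P) where

  m : ℕ
  m = span P

  a : ℕ → ℤ
  a = nth (coeffs (normalize P))

  A : Matrix m
  A = companion P

  private
    mid : List ℤ
    mid = proj₁ bim

  m≡ : m ≡ suc (length mid)
  m≡ = trans (cong (λ l → length l ℕ.∸ 1) (proj₂ bim))
             (trans (List.length-++ mid) (ℕ.+-comm (length mid) 1))

  length≡ : length (coeffs (normalize P)) ≡ suc m
  length≡ = trans (cong length (proj₂ bim))
    (cong suc (trans (List.length-++ mid) (trans (ℕ.+-comm (length mid) 1) (sym m≡))))

  a₀ : a 0 ≡ + 1
  a₀ = cong (λ l → nth l 0) (proj₂ bim)

  aₘ : a m ≡ + 1
  aₘ = trans (cong₂ nth (proj₂ bim) m≡) (nth-last mid (+ 1))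

  δ0m : δ 0 m ≡ + 0
  δ0m = cong (δ 0) m≡

  A-·ᵥ : ∀ x i → (A ·ᵥ x) i ≡
    sumℤ m (λ j → δ (suc (toℕ i)) (toℕ j) * x j) - δ (suc (toℕ i)) m * sumℤ m (λ j → a (toℕ j) * x j)
  A-·ᵥ x i = begin
    sumℤ m (λ j → A i j * x j)
      ≡⟨ sum-cong m (λ j → trans (cong (_* x j) (companion-entry P i j))
           (e (δ (suc (toℕ i)) (toℕ j)) (δ (suc (toℕ i)) m) (a (toℕ j)) (x j))) ⟩
    sumℤ m (λ j → δ (suc (toℕ i)) (toℕ j) * x j + (- δ (suc (toℕ i)) m) * (a (toℕ j) * x j))
      ≡⟨ sum-+ m _ _ ⟩
    sumℤ m (λ j → δ (suc (toℕ i)) (toℕ j) * x j) + sumℤ m (λ j → (- δ (suc (toℕ i)) m) * (a (toℕ j) * x j))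
      ≡⟨ cong (_+_ (sumℤ m (λ j → δ (suc (toℕ i)) (toℕ j) * x j)))
           (trans (sum-* m (- δ (suc (toℕ i)) m) (λ j → a (toℕ j) * x j))
                  (sym (ℤ.neg-distribˡ-* (δ (suc (toℕ i)) m) _))) ⟩
    sumℤ m (λ j → δ (suc (toℕ i)) (toℕ j) * x j) - δ (suc (toℕ i)) m * sumℤ m (λ j → a (toℕ j) * x j) ∎
    where
    open ≡-Reasoning
    e : ∀ p q r x → (p - q * r) * x ≡ p * x + (- q) * (r * x)
    e = solve-∀

  -- The rows above the last one read off the coordinates of `x` with positive index. Once these
  -- vanish, the last row is -`a 0` times the remaining coordinate, and `a 0` = 1 by bimonicity.
  A-injective : ∀ x → A ·ᵥ x ≗ 𝟎 → x ≗ 𝟎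
  A-injective x Ax≡0 i = go i (toℕ i) refl
    where
    tail : ∀ (j : Fin m) t → toℕ j ≡ suc t → x j ≡ + 0
    tail j t j≡ = trans (sym (trans (A-·ᵥ x r) (trans (cong₂ (λ p q → p - q * S) sum≡ (δ-≢ (ℕ.<⇒≢ r<m)))
                                                      (ℤ.+-identityʳ (x j))))) (Ax≡0 r)
      where
      S : ℤ
      S = sumℤ m (λ j → a (toℕ j) * x j)
      t<m : t < m
      t<m = ℕ.<-trans (subst (t <_) (sym j≡) (ℕ.n<1+n t)) (F.toℕ<n j)
      r : Fin m
      r = F.fromℕ< t<m
      r≡ : suc (toℕ r) ≡ toℕ j
      r≡ = trans (cong suc (F.toℕ-fromℕ< t<m)) (sym j≡)
      r<m : suc (toℕ r) < m
      r<m = subst (_< m) (sym r≡) (F.toℕ<n j)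
      sum≡ : sumℤ m (λ l → δ (suc (toℕ r)) (toℕ l) * x l) ≡ x j
      sum≡ = trans (sum-cong m (λ l → cong (_* x l)
        (trans (cong (λ t → δ t (toℕ l)) r≡) (δ-sym (toℕ j) (toℕ l))))) (sum-δ m x j)
    go : ∀ (j : Fin m) t → toℕ j ≡ t → x j ≡ + 0
    go j (suc t) j≡ = tail j t j≡
    go j zero    j≡ = trans (sym sum≡)
      (ℤ.neg-injective (trans (sym (ℤ.+-identityˡ (- S))) (trans (sym row) (Ax≡0 r))))
      where
      S : ℤ
      S = sumℤ m (λ l → a (toℕ l) * x l)
      l<m : length mid < m
      l<m = subst (length mid <_) (sym m≡) (ℕ.n<1+n (length mid))
      r : Fin m
      r = F.fromℕ< l<m
      r≡ : suc (toℕ r) ≡ m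
      r≡ = trans (cong suc (F.toℕ-fromℕ< l<m)) (sym m≡)
      sum≡ : S ≡ x j
      sum≡ = trans (sum-cong m term) (sum-δ m x j)
        where
        term : ∀ l → a (toℕ l) * x l ≡ δ (toℕ l) (toℕ j) * x l
        term l with toℕ l in l≡
        ... | zero  = cong (_* x l) (trans a₀ (sym (cong (δ 0) j≡)))
        ... | suc t = trans (trans (cong (a (suc t) *_) (tail l t l≡)) (ℤ.*-zeroʳ (a (suc t))))
                      (sym (cong (_* x l) (cong (δ (suc t)) j≡)))
      row : (A ·ᵥ x) r ≡ + 0 - S
      row = trans (A-·ᵥ x r) (cong₂ _-_
        (sum-0 m (λ l → cong (_* x l) (δ-≢ (λ q → ℕ.<⇒≢ (F.toℕ<n l) (trans (sym q) r≡)))))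
        (trans (cong (λ q → q * S) (trans (cong (λ t → δ t m) r≡) (δ-refl m))) (ℤ.*-identityˡ S)))

  module _ (B : Matrix m) (AB≡I : ∀ i j → (A ·ₘ B) i j ≡ Iₘ i j) where

    A-B : ∀ x → A ·ᵥ (B ·ᵥ x) ≗ x
    A-B x i = trans (sym (·ₘ-·ᵥ A B x i))
      (trans (sum-cong m (λ j → cong (_* x j) (AB≡I i j))) (Iₘ-·ᵥ x i))

    -- `A` annihilates `B` `A` `x` - `x` because `B` is a right inverse; injectivity of `A` then
    -- makes it a left inverse.
    B-A : ∀ x → B ·ᵥ (A ·ᵥ x) ≗ x
    B-A x i = ℤ.i-j≡0⇒i≡j _ _ (A-injective (B ·ᵥ (A ·ᵥ x) ⊖ x) (λ j →
      trans (⊖-homo (matrix-linear A) (B ·ᵥ (A ·ᵥ x)) x j) (ℤ.i≡j⇒i-j≡0 (A-B (A ·ᵥ x) j))) i)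

    companion-action : Action (Fin m)
    companion-action = Powers.powers (matrix-linear A) (matrix-linear B) A-B B-A

-- The cokernel of the companion expression as a cyclic module

module CompanionModule (k n : ℕ) (s : Fin k → ℕ) (bim : Bimonic (polyP k s))
  (B : Matrix (span (polyP k s)))
  (AB≡I : ∀ i j → (companion (polyP k s) ·ₘ B) i j ≡ Iₘ i j) where

  open Companion (polyP k s) bim public

  action : Action (Fin m)
  action = companion-action B AB≡I

  module V = Residues k n s action

  matrix-power : ∀ e w → ((A ^ₘ e) ·ᵥ w) ≗ V.σ (+ e) w
  matrix-power zero    w   = Iₘ-·ᵥ w
  matrix-power (suc e) w i = trans (·ₘ-·ᵥ A (A ^ₘ e) w i)
    (≗-cong (matrix-linear A) (matrix-power e w) i)

  matrix-power⁻ : ∀ e w → ((B ^ₘ e) ·ᵥ w) ≗ V.σ (- + e) w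
  matrix-power⁻ zero          w   = Iₘ-·ᵥ w
  matrix-power⁻ (suc zero)    w i = trans (·ₘ-·ᵥ B Iₘ w i) (≗-cong (matrix-linear B) (Iₘ-·ᵥ w) i)
  matrix-power⁻ (suc (suc e)) w i = trans (·ₘ-·ᵥ B (B ^ₘ suc e) w i)
    (≗-cong (matrix-linear B) (matrix-power⁻ (suc e) w) i)

  cokerMatrix-M : ∀ w → (cokerMatrix n k s A B ·ᵥ w) ≗ V.M w
  cokerMatrix-M w i = begin
    sumℤ m (λ j → (An i j - c * Iₘ i j + sumℤ k (λ t → T t i j)) * w j)
      ≡⟨ sum-cong m (λ j → trans (e₁ (An i j) c (Iₘ i j) (sumℤ k (λ t → T t i j)) (w j))
           (cong (λ z → An i j * w j + (- c) * (Iₘ i j * w j) + z)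
                 (trans (sym (sum-* k (w j) (λ t → T t i j)))
                        (sum-cong k (λ t → e₂ (w j) ((A ^ₘ s t) i j) ((B ^ₘ s t) i j)))))) ⟩
    sumℤ m (λ j → An i j * w j + (- c) * (Iₘ i j * w j) + sumℤ k (λ t → Tw t j))
      ≡⟨ trans (sum-+ m _ _) (cong₂ _+_
           (trans (sum-+ m _ _) (cong₂ _+_ (matrix-power n w i)
             (trans (sum-* m (- c) (λ j → Iₘ i j * w j)) (cong (- c *_) (Iₘ-·ᵥ w i)))))
           (trans (sum-swap m k (λ j t → Tw t j)) (sum-cong k (λ t →
             trans (sum-+ m _ _) (cong₂ _+_ (matrix-power (s t) w i) (matrix-power⁻ (s t) w i)))))) ⟩
    V.σ (+ n) w i + (- c) * w i + sumℤ k (λ t → V.σ (+ s t) w i + V.σ (- + s t) w i)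
      ≡⟨ e₃ (V.σ (+ n) w i) c (w i) _ ⟩
    V.σ (+ n) w i - (c * w i - sumℤ k (λ t → V.σ (+ s t) w i + V.σ (- + s t) w i)) ∎
    where
    open ≡-Reasoning
    c : ℤ
    c = + (2 ℕ.* k ℕ.+ 2)
    An : Matrix m
    An = A ^ₘ n
    T : Fin k → Matrix m
    T t = (A ^ₘ s t) +ₘ (B ^ₘ s t)
    Tw : Fin k → Fin m → ℤ
    Tw t j = (A ^ₘ s t) i j * w j + (B ^ₘ s t) i j * w j
    e₁ : ∀ a c d t w → (a - c * d + t) * w ≡ a * w + (- c) * (d * w) + w * t
    e₁ = solve-∀
    e₂ : ∀ w a b → w * (a + b) ≡ a * w + b * w
    e₂ = solve-∀
    e₃ : ∀ a c w t → a + (- c) * w + t ≡ a - (c * w - t)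
    e₃ = solve-∀

  -- Written with `suc` on the row index to match `companion-entry`: column l of `A` is the basis
  -- vector l-1 (zero when l = 0) minus `a l` times the generator.
  generator : Fin m → ℤ
  generator i = δ (suc (toℕ i)) m

  -- Descending induction on `j`, with `d` = `m` - `j`. At `j` = `m` only the leading coefficient 1
  -- is left, which gives the generator. In the step the summand `a j` times the generator cancels
  -- against the last row of `A`, and the basis vector moves down by one. At `j` = 0 it has left the
  -- index range: this is the exact relation q² - 1 = 0 on the generator.
  horner-generator : ∀ d j → j ℕ.+ d ≡ m → ∀ i → V.horner j generator i ≡ δ (suc (toℕ i)) j
  horner-generator zero j j≡ i = begin
    V.horner j generator i
      ≡⟨ V.horner-step j generator i ⟩
    a j * generator i + (A ·ᵥ V.horner (suc j) generator) i
      ≡⟨ cong₂ _+_ (trans (cong (λ t → a t * generator i) j≡m)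
                          (trans (cong (_* generator i) aₘ) (ℤ.*-identityˡ (generator i))))
           (trans (≗-cong (matrix-linear A) (V.horner-end (suc j) m<j generator) i)
                  (𝟎-homo (matrix-linear A) i)) ⟩
    generator i + + 0
      ≡⟨ ℤ.+-identityʳ (generator i) ⟩
    generator i
      ≡⟨ cong (δ (suc (toℕ i))) (sym j≡m) ⟩
    δ (suc (toℕ i)) j ∎
    where
    open ≡-Reasoning
    j≡m : j ≡ m
    j≡m = trans (sym (ℕ.+-identityʳ j)) j≡
    m<j : length V.cs ≤ suc j
    m<j = ℕ.≤-reflexive (trans length≡ (cong suc (sym j≡m)))
  horner-generator (suc d) j j≡ i = begin
    V.horner j generator i
      ≡⟨ V.horner-step j generator i ⟩
    a j * generator i + (A ·ᵥ V.horner (suc j) generator) i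
      ≡⟨ cong (_+_ (a j * generator i))
           (trans (≗-cong (matrix-linear A) next i) (·ᵥ-basis A l i)) ⟩
    a j * generator i + A i l
      ≡⟨ cong (_+_ (a j * generator i)) (trans (companion-entry (polyP k s) i l)
           (cong (λ t → δ (suc (toℕ i)) t - generator i * a t) l≡j)) ⟩
    a j * generator i + (δ (suc (toℕ i)) j - generator i * a j)
      ≡⟨ e (a j) (generator i) (δ (suc (toℕ i)) j) ⟩
    δ (suc (toℕ i)) j ∎
    where
    open ≡-Reasoning
    j+d≡m : suc j ℕ.+ d ≡ m
    j+d≡m = trans (sym (ℕ.+-suc j d)) j≡
    j<m : j < m
    j<m = subst (suc j ≤_) j+d≡m (ℕ.m≤m+n (suc j) d)
    l : Fin m
    l = F.fromℕ< j<m
    l≡j : toℕ l ≡ j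
    l≡j = F.toℕ-fromℕ< j<m
    next : V.horner (suc j) generator ≗ basis l
    next i = trans (horner-generator d (suc j) j+d≡m i) (cong (δ (toℕ i)) (sym l≡j))
    e : ∀ a g d → a * g + (d - g * a) ≡ d
    e = solve-∀

  horner-generator₀ : V.horner 0 generator ≗ 𝟎
  horner-generator₀ = horner-generator m 0 refl

  horner-generator-suc : ∀ l → V.horner (suc (toℕ l)) generator ≗ basis l
  horner-generator-suc l = horner-generator (m ℕ.∸ suc (toℕ l)) (suc (toℕ l)) (ℕ.m+[n∸m]≡n (F.toℕ<n l))

  -- χ is the ℤ[z]-module homomorphism modulo im M that sends the generator to v.
  module Extend {J : Set} (𝒴 : Action J) (v : J → ℤ) where

    private
      module Y = Residues k n s 𝒴

      H : ℕ → J → ℤ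
      H j = Y.horner j v

    χ : (Fin m → ℤ) → J → ℤ
    χ y = Σᵥ m (λ j → y j ⊙ H (suc (toℕ j)))

    χ-linear : Linear χ
    χ-linear = combination-linear (λ j → H (suc (toℕ j)))

    χ-basis : ∀ l → χ (basis l) ≗ H (suc (toℕ l))
    χ-basis = combination-basis (λ j → H (suc (toℕ j)))

    Hₘ : H m ≗ v
    Hₘ i = trans (Y.horner-step m v i) (trans (cong₂ _+_
      (trans (cong (_* v i) aₘ) (ℤ.*-identityˡ (v i)))
      (trans (≗-cong (Y.σ-linear (+ 1)) (Y.horner-end (suc m) (ℕ.≤-reflexive length≡) v) i)
             (𝟎-homo (Y.σ-linear (+ 1)) i)))
      (ℤ.+-identityʳ (v i)))

    -- The sum over `j` runs through the tails 1 to `m`; adding the term of tail 0 turns it into a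
    -- δ-sum over `suc m` indices, so that the extreme values `l` = 0 and `l` = `m` need no separate
    -- treatment.
    shifted-sum : ∀ {l} → l ≤ m → ∀ i →
      δ 0 l * H 0 i + sumℤ m (λ j → δ (suc (toℕ j)) l * H (suc (toℕ j)) i) ≡ H l i
    shifted-sum l≤m i = sum-δ-ℕ {suc m} (s≤s l≤m) (λ j → H j i)

    χ-generator : χ generator ≗ v
    χ-generator i = trans (sym (trans
      (cong (_+ χ generator i) (trans (cong (_* H 0 i) δ0m) (ℤ.*-zeroˡ (H 0 i))))
      (ℤ.+-identityˡ (χ generator i))))
      (trans (shifted-sum ℕ.≤-refl i) (Hₘ i))

    -- Column l of `A` turns into tail l minus `a l` times `v`, which is z times tail l+1 by the
    -- Horner recursion. Only l = 0 deviates, as there is no basis vector -1; the defect `H 0` is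
    -- exactly what the relation on `v` has to kill.
    χ-A-basis : ∀ l → χ (A ·ᵥ basis l) ≗ Y.σ (+ 1) (H (suc (toℕ l))) ⊖ δ 0 (toℕ l) ⊙ H 0
    χ-A-basis l i = begin
      sumℤ m (λ j → (A ·ᵥ basis l) j * H (suc (toℕ j)) i)
        ≡⟨ sum-cong m (λ j → trans
             (cong (_* H (suc (toℕ j)) i) (trans (·ᵥ-basis A l j) (companion-entry (polyP k s) j l)))
             (e₁ (δ (suc (toℕ j)) (toℕ l)) (generator j) (a (toℕ l)) (H (suc (toℕ j)) i))) ⟩
      sumℤ m (λ j → δ (suc (toℕ j)) (toℕ l) * H (suc (toℕ j)) i
                      + (- a (toℕ l)) * (generator j * H (suc (toℕ j)) i))
        ≡⟨ trans (sum-+ m _ _) (cong₂ _+_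
             (e₂ (δ 0 (toℕ l) * H 0 i) S (H (toℕ l) i) (shifted-sum (ℕ.<⇒≤ (F.toℕ<n l)) i))
             (trans (sum-* m (- a (toℕ l)) _) (cong (- a (toℕ l) *_) (χ-generator i)))) ⟩
      H (toℕ l) i - δ 0 (toℕ l) * H 0 i + (- a (toℕ l)) * v i
        ≡⟨ cong (λ h → h - δ 0 (toℕ l) * H 0 i + (- a (toℕ l)) * v i) (Y.horner-step (toℕ l) v i) ⟩
      a (toℕ l) * v i + Y.σ (+ 1) (H (suc (toℕ l))) i - δ 0 (toℕ l) * H 0 i + (- a (toℕ l)) * v i
        ≡⟨ e₃ (a (toℕ l)) (v i) (Y.σ (+ 1) (H (suc (toℕ l))) i) (δ 0 (toℕ l) * H 0 i) ⟩
      Y.σ (+ 1) (H (suc (toℕ l))) i - δ 0 (toℕ l) * H 0 i ∎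
      where
      open ≡-Reasoning
      S : ℤ
      S = sumℤ m (λ j → δ (suc (toℕ j)) (toℕ l) * H (suc (toℕ j)) i)
      e₁ : ∀ d g a h → (d - g * a) * h ≡ d * h + (- a) * (g * h)
      e₁ = solve-∀
      e₂ : ∀ p q r → p + q ≡ r → q ≡ r - p
      e₂ p q r refl = e p q
        where
        e : ∀ p q → q ≡ p + q - p
        e = solve-∀
      e₃ : ∀ a v t d → a * v + t - d + (- a) * v ≡ t - d
      e₃ = solve-∀

    χ-σ₁ : H 0 Y.∼ 𝟎 → ∀ y → χ (V.σ (+ 1) y) Y.∼ Y.σ (+ 1) (χ y)
    χ-σ₁ H₀∼𝟎 = Y.linear-ext (∘-linear χ-linear (matrix-linear A))
      (∘-linear (Y.σ-linear (+ 1)) χ-linear) λ l →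
      Y.∼-trans (Y.≗⇒∼ (χ-A-basis l))
      (Y.∼-trans (Y.⊖-cong (Y.∼-refl (Y.σ (+ 1) (H (suc (toℕ l))))) (Y.⊙-cong (δ 0 (toℕ l)) H₀∼𝟎))
      (Y.≗⇒∼ (λ i → trans (e (Y.σ (+ 1) (H (suc (toℕ l))) i) (δ 0 (toℕ l)))
        (≗-cong (Y.σ-linear (+ 1)) (λ i → sym (χ-basis l i)) i))))
      where
      e : ∀ t d → t - d * + 0 ≡ t
      e = solve-∀

-- The circulant graph

module Rotation (N′ : ℕ) where

  N : ℕ
  N = suc N′

  residue-unique : ∀ (u v : Fin N) q → + toℕ u ≡ + toℕ v + q * + N → u ≡ v
  residue-unique u v q eq = F.toℕ-injective (ℤ.+-injective (ℤ.i-j≡0⇒i≡j _ _ (ℤ.∣i∣≡0⇒i≡0 (small _ ∣d∣<N N∣d))))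
    where
    e : ∀ a b → a + b - a ≡ b
    e = solve-∀
    difference : + toℕ u - + toℕ v ≡ q * + N
    difference = trans (cong (_- + toℕ v) eq) (e (+ toℕ v) (q * + N))
    N∣d : N ∣ ∣ + toℕ u - + toℕ v ∣
    N∣d = divides ∣ q ∣ (trans (cong ∣_∣ difference) (ℤ.abs-* q (+ N)))
    ∣d∣<N : ∣ + toℕ u - + toℕ v ∣ < N
    ∣d∣<N = ℕ.≤-<-trans
      (ℕ.≤-trans (ℕ.≤-reflexive (cong ∣_∣ (ℤ.[+m]-[+n]≡m⊖n (toℕ u) (toℕ v)))) (ℤ.∣m⊝n∣≤m⊔n (toℕ u) (toℕ v)))
      (ℕ.⊔-lub (F.toℕ<n u) (F.toℕ<n v))
    small : ∀ t → t < N → N ∣ t → t ≡ 0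
    small zero    _   _   = refl
    small (suc t) t<N N∣t = ⊥-elim (>⇒∤ t<N N∣t)

  rot : ℤ → Fin N → Fin N
  rot d u = F.fromℕ< (n%ℕd<d (+ toℕ u + d) N)

  rot-quotient : ℤ → Fin N → ℤ
  rot-quotient d u = (+ toℕ u + d) /ℕ N

  rot-spec : ∀ d u → + toℕ u + d ≡ + toℕ (rot d u) + rot-quotient d u * + N
  rot-spec d u = trans (a≡a%ℕn+[a/ℕn]*n (+ toℕ u + d) N)
    (cong (λ t → + t + rot-quotient d u * + N) (sym (F.toℕ-fromℕ< (n%ℕd<d (+ toℕ u + d) N))))

  rot-unique : ∀ d u v q → + toℕ u + d ≡ + toℕ v + q * + N → rot d u ≡ v
  rot-unique d u v q eq = residue-unique (rot d u) v (q - rot-quotient d u)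
    (trans (e₁ (+ toℕ (rot d u)) (rot-quotient d u * + N))
    (trans (cong (_- rot-quotient d u * + N) (trans (sym (rot-spec d u)) eq))
           (e₂ (+ toℕ v) q (rot-quotient d u) (+ N))))
    where
    e₁ : ∀ r p → r ≡ r + p - p
    e₁ = solve-∀
    e₂ : ∀ v q p N → v + q * N - p * N ≡ v + (q - p) * N
    e₂ = solve-∀

  rot-multiple : ∀ q u → rot (q * + N) u ≡ u
  rot-multiple q u = rot-unique (q * + N) u u q refl

  rot-+ : ∀ d e u → rot (d + e) u ≡ rot e (rot d u)
  rot-+ d e u = rot-unique (d + e) u (rot e (rot d u)) (rot-quotient d u + rot-quotient e (rot d u))
    (trans (e₁ (+ toℕ u) d e)
    (trans (cong (_+ e) (rot-spec d u))
    (trans (e₂ (+ toℕ (rot d u)) (rot-quotient d u) (+ N) e)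
    (trans (cong (_+ rot-quotient d u * + N) (rot-spec e (rot d u)))
           (e₃ (+ toℕ (rot e (rot d u))) (rot-quotient d u) (rot-quotient e (rot d u)) (+ N))))))
    where
    e₁ : ∀ u d e → u + (d + e) ≡ u + d + e
    e₁ = solve-∀
    e₂ : ∀ r p N e → r + p * N + e ≡ r + e + p * N
    e₂ = solve-∀
    e₃ : ∀ r p p′ N → r + p′ * N + p * N ≡ r + (p + p′) * N
    e₃ = solve-∀

  rot-0 : ∀ u → rot (+ 0) u ≡ u
  rot-0 = rot-multiple (+ 0)

  rot-inverse : ∀ {d e} → d + e ≡ + 0 → ∀ u → rot e (rot d u) ≡ u
  rot-inverse {d} {e} p u = trans (sym (rot-+ d e u)) (trans (cong (λ c → rot c u) p) (rot-0 u))

  rotation : Action (Fin N)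
  rotation = record
    { σ        = λ d x → x ∘ rot d
    ; σ-linear = λ d → record
      { ≗-cong = λ p u → p (rot d u) ; ⊕-homo = λ _ _ _ → refl ; ⊙-homo = λ _ _ _ → refl }
    ; σ-0      = λ x u → cong x (rot-0 u)
    ; σ-+      = λ d e x u → cong x (rot-+ d e u)
    }

  open Action rotation

  -- Precomposing with a rotation moves the basis vectors backwards. This is the origin of the
  -- negative exponents in `ψ` and `σ-basis-zero`.
  σ-basis : ∀ d v → σ d (basis v) ≗ basis (rot (- d) v)
  σ-basis d v u with u F.≟ rot (- d) v
  ... | yes u≡ = trans (trans (cong (λ t → δ (toℕ t) (toℕ v))
                         (trans (cong (rot d) u≡) (rot-inverse { - d} {d} (ℤ.+-inverseˡ d) v))) (δ-refl (toℕ v)))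
                   (sym (trans (cong (λ t → δ (toℕ t) (toℕ (rot (- d) v))) u≡) (δ-refl (toℕ (rot (- d) v)))))
  ... | no u≢  = trans
      (δ-≢ {toℕ (rot d u)} (λ q → u≢ (trans (sym (rot-inverse {d} { - d} (ℤ.+-inverseʳ d) u))
                                          (cong (rot (- d)) (F.toℕ-injective q)))))
      (sym (δ-≢ (u≢ ∘ F.toℕ-injective)))

  rot-from-zero : ∀ u → rot (+ toℕ u) F.zero ≡ u
  rot-from-zero u = rot-unique (+ toℕ u) F.zero u (+ 0) (e (+ toℕ u) (+ N))
    where
    e : ∀ a N → + 0 + a ≡ a + + 0 * N
    e = solve-∀

  σ-basis-zero : ∀ u → σ (- + toℕ u) (basis F.zero) ≗ basis u
  σ-basis-zero u i = trans (σ-basis (- + toℕ u) F.zero i)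
    (cong (λ v → basis v i) (trans (cong (λ d → rot d F.zero) (ℤ.neg-involutive (+ toℕ u))) (rot-from-zero u)))

  -- Expansion in basis vectors replaces a reindexing of the sum: a rotation only moves the single 1
  -- of a basis vector.
  σ-sum : ∀ d x → sumℤ N (σ d x) ≡ sumℤ N x
  σ-sum d x = begin
    sumℤ N (σ d x)
      ≡⟨ sum-cong N (linear-expansion (σ-linear d) x) ⟩
    sumℤ N (Σᵥ N (λ u → x u ⊙ σ d (basis u)))
      ≡⟨ sum-swap N N (λ i u → x u * σ d (basis u) i) ⟩
    sumℤ N (λ u → sumℤ N (x u ⊙ σ d (basis u)))
      ≡⟨ sum-cong N (λ u → trans (sum-* N (x u) (σ d (basis u)))
           (trans (cong (x u *_) (trans (sum-cong N (σ-basis d u)) (basis-sum (rot (- d) u))))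
                  (ℤ.*-identityʳ (x u)))) ⟩
    sumℤ N x ∎
    where
    open ≡-Reasoning
    basis-sum : ∀ (v : Fin N) → sumℤ N (basis v) ≡ + 1
    basis-sum v = trans (sum-cong N (λ u → sym (ℤ.*-identityʳ (basis v u)))) (sum-δ N (λ _ → + 1) v)

  circulant-entry : ∀ d u v → N ∣ ∣ (+ toℕ u + d) - + toℕ v ∣ → rot d u ≡ v
  circulant-entry d u v N∣ with ∣ᵤ⇒∣ {+ N} {(+ toℕ u + d) - + toℕ v} N∣
  ... | Signed.divides q eq = rot-unique d u v q (trans (e (+ toℕ u + d) (+ toℕ v)) (cong (_+_ (+ toℕ v)) eq))
    where
    e : ∀ a b → a ≡ b + (a - b)
    e = solve-∀

  circulant-entry⁻¹ : ∀ d u → N ∣ ∣ (+ toℕ u + d) - + toℕ (rot d u) ∣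
  circulant-entry⁻¹ d u = divides ∣ rot-quotient d u ∣ (trans (cong ∣_∣
    (trans (cong (_- + toℕ (rot d u)) (rot-spec d u)) (e (+ toℕ (rot d u)) (rot-quotient d u * + N))))
    (ℤ.abs-* (rot-quotient d u) (+ N)))
    where
    e : ∀ a b → a + b - a ≡ b
    e = solve-∀

  -- Adjacency counts jumps with multiplicity, so each jump contributes the indicator of its own
  -- endpoint. Summation against a vector then turns the adjacency matrix into a sum of shifts.
  circulant-∷ : ∀ d ds u v → + circulant N (d ∷ ds) u v ≡ δ (toℕ v) (toℕ (rot d u)) + + circulant N ds u v
  circulant-∷ d ds u v = by-cases (edge? d)
    where
    edge? : ∀ d → Dec (N ∣ ∣ (+ toℕ u + d) - + toℕ v ∣)
    edge? d = N ∣? ∣ (+ toℕ u + d) - + toℕ v ∣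
    by-cases : Dec (N ∣ ∣ (+ toℕ u + d) - + toℕ v ∣) →
               + circulant N (d ∷ ds) u v ≡ δ (toℕ v) (toℕ (rot d u)) + + circulant N ds u v
    by-cases (yes N∣) = trans (cong (λ l → + length l) (List.filter-accept edge? {d} {ds} N∣))
      (cong (_+ + circulant N ds u v)
        (sym (trans (cong (λ t → δ (toℕ v) (toℕ t)) (circulant-entry d u v N∣)) (δ-refl (toℕ v)))))
    by-cases (no N∤)  = trans (cong (λ l → + length l) (List.filter-reject edge? {d} {ds} N∤))
      (sym (trans (cong (_+ + circulant N ds u v)
        (δ-≢ (λ q → N∤ (subst (λ t → N ∣ ∣ (+ toℕ u + d) - + toℕ t ∣)
          (sym (F.toℕ-injective q)) (circulant-entry⁻¹ d u))))) (ℤ.+-identityˡ (+ circulant N ds u v))))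

  sumList : List ℤ → (Fin N → ℤ) → Fin N → ℤ
  sumList []       x = 𝟎
  sumList (d ∷ ds) x = σ d x ⊕ sumList ds x

  sumList-++ : ∀ ds es x → sumList (ds ++ es) x ≗ sumList ds x ⊕ sumList es x
  sumList-++ []       es x u = sym (ℤ.+-identityˡ _)
  sumList-++ (d ∷ ds) es x u = trans (cong (_+_ (σ d x u)) (sumList-++ ds es x u))
    (sym (ℤ.+-assoc (σ d x u) (sumList ds x u) (sumList es x u)))

  circulant-sum : ∀ ds x u → sumℤ N (λ v → + circulant N ds u v * x v) ≡ sumList ds x u
  circulant-sum []       x u = sum-0 N (λ _ → refl)
  circulant-sum (d ∷ ds) x u = begin
    sumℤ N (λ v → + circulant N (d ∷ ds) u v * x v)
      ≡⟨ sum-cong N (λ v → trans (cong (_* x v) (circulant-∷ d ds u v))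
           (ℤ.*-distribʳ-+ (x v) (δ (toℕ v) (toℕ (rot d u))) (+ circulant N ds u v))) ⟩
    sumℤ N (λ v → δ (toℕ v) (toℕ (rot d u)) * x v + + circulant N ds u v * x v)
      ≡⟨ trans (sum-+ N (λ v → δ (toℕ v) (toℕ (rot d u)) * x v) (λ v → + circulant N ds u v * x v)) (cong₂ _+_ (sum-δ N x (rot d u)) (circulant-sum ds x u)) ⟩
    σ d x u + sumList ds x u ∎
    where
    open ≡-Reasoning

  circJumps-sum : ∀ n k s x →
    sumList (circJumps n k s) x ≗ σ (+ n) x ⊕ Σᵥ k (λ j → σ (+ s j) x ⊕ σ (- + s j) x)
  circJumps-sum n k s x u = cong (_+_ (σ (+ n) x u)) (jumps k s)
    where
    jumps : ∀ k (s : Fin k → ℕ) → sumList (ΣFin _++_ [] k (λ j → + s j ∷ - + s j ∷ [])) x u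
            ≡ sumℤ k (λ j → σ (+ s j) x u + σ (- + s j) x u)
    jumps zero    s = refl
    jumps (suc k) s = trans
      (sumList-++ (+ s F.zero ∷ - + s F.zero ∷ []) (ΣFin _++_ [] k (λ j → + s (F.suc j) ∷ - + s (F.suc j) ∷ [])) x u)
      (cong₂ _+_ (cong (_+_ (σ (+ s F.zero) x u)) (ℤ.+-identityʳ (σ (- + s F.zero) x u))) (jumps k (s ∘ F.suc)))

-- The homomorphisms ψ and χ and their composites

module Correspondence (k n′ : ℕ) (s : Fin k → ℕ) (bim : Bimonic (polyP k s))
  (B : Matrix (span (polyP k s)))
  (AB≡I : ∀ i j → (companion (polyP k s) ·ₘ B) i j ≡ Iₘ i j) where

  n : ℕ
  n = suc n′

  open CompanionModule k n s bim B AB≡I public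
  -- `2 * suc n′` reduces to the successor of this argument, so `N` is definitionally the number of
  -- vertices of `Circ`.
  open Rotation (n′ ℕ.+ (suc n′ ℕ.+ 0)) public

  module U = Residues k n s rotation

  N≡n+n : + n + + n ≡ + N
  N≡n+n = cong (λ t → + (n ℕ.+ t)) (sym (ℕ.+-identityʳ n))

  origin : Fin N → ℤ
  origin = basis F.zero

  ψ : (Fin N → ℤ) → Fin m → ℤ
  ψ x = Σᵥ N (λ u → x u ⊙ V.σ (- + toℕ u) generator)

  ψ-linear : Linear ψ
  ψ-linear = combination-linear (λ u → V.σ (- + toℕ u) generator)

  ψ-basis : ∀ u → ψ (basis u) ≗ V.σ (- + toℕ u) generator
  ψ-basis = combination-basis (λ u → V.σ (- + toℕ u) generator)

  period : V.σ (+ N) generator V.∼ generator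
  period = V.∼-trans
    (V.≗⇒∼ (λ i → trans (cong (λ d → V.σ d generator i) (sym N≡n+n)) (V.σ-+ (+ n) (+ n) generator i)))
    (V.σnσn-fixed generator horner-generator₀)

  periodic : ∀ q → V.σ (q * + N) generator V.∼ generator
  periodic = ℤ-induction (λ q → V.σ (q * + N) generator V.∼ generator) base up down
    where
    base : V.σ (+ 0 * + N) generator V.∼ generator
    base = V.≗⇒∼ (λ i → cong (λ d → V.σ d generator i) (ℤ.*-zeroˡ (+ N)))
    step : ∀ q → V.σ ((+ 1 + q) * + N) generator ≗ V.σ (+ N) (V.σ (q * + N) generator)
    step q i = trans (cong (λ d → V.σ d generator i) (ℤ.suc-* q (+ N))) (V.σ-+ (+ N) (q * + N) generator i)
    up : ∀ q → V.σ (q * + N) generator V.∼ generator → V.σ ((+ 1 + q) * + N) generator V.∼ generator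
    up q ih = V.∼-trans (V.≗⇒∼ (step q)) (V.∼-trans (V.σ-cong (+ N) ih) period)
    cancel : ∀ y → V.σ (- + N) (V.σ (+ N) y) V.∼ y
    cancel y = V.≗⇒∼ (V.σ-inverse { - + N} {+ N} (ℤ.+-inverseˡ (+ N)) y)
    down : ∀ q → V.σ ((+ 1 + q) * + N) generator V.∼ generator → V.σ (q * + N) generator V.∼ generator
    down q ih = V.∼-trans (V.∼-sym (cancel (V.σ (q * + N) generator)))
      (V.∼-trans (V.σ-cong (- + N) (V.∼-trans (V.∼-sym (V.≗⇒∼ (step q)))
                                   (V.∼-trans ih (V.∼-sym period))))
                 (cancel generator))

  -- z sends δ_u to δ_r with r the residue of u - 1. The exponents -r and 1 - u differ by a multiple
  -- of `N`, nonzero only when u = 0 wraps around, and `periodic` absorbs it.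
  ψ-σ₁ : ∀ x → ψ (U.σ (+ 1) x) V.∼ V.σ (+ 1) (ψ x)
  ψ-σ₁ = V.linear-ext (∘-linear ψ-linear (U.σ-linear (+ 1))) (∘-linear (V.σ-linear (+ 1)) ψ-linear) on-basis
    where
    on-basis : ∀ u → ψ (U.σ (+ 1) (basis u)) V.∼ V.σ (+ 1) (ψ (basis u))
    on-basis u = V.∼-trans
      (V.≗⇒∼ (λ i → trans (≗-cong ψ-linear (σ-basis (+ 1) u) i) (trans (ψ-basis r i)
        (trans (cong (λ d → V.σ d generator i) exponent)
               (V.σ-+ (+ 1 + - + toℕ u) (q * + N) generator i)))))
      (V.∼-trans (V.σ-cong (+ 1 + - + toℕ u) (periodic q))
      (V.≗⇒∼ (λ i → trans (V.σ-+ (+ 1) (- + toℕ u) generator i)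
        (≗-cong (V.σ-linear (+ 1)) (λ i → sym (ψ-basis u i)) i))))
      where
      r : Fin N
      r = rot (- + 1) u
      q : ℤ
      q = rot-quotient (- + 1) u
      e : ∀ u r p → u + - + 1 ≡ r + p → - r ≡ + 1 + - u + p
      e u r p eq = trans (e₁ r p) (trans (cong (λ t → p - t) (sym eq)) (e₂ u p))
        where
        e₁ : ∀ r p → - r ≡ p - (r + p)
        e₁ = solve-∀
        e₂ : ∀ u p → p - (u + - + 1) ≡ + 1 + - u + p
        e₂ = solve-∀
      exponent : - + toℕ r ≡ + 1 + - + toℕ u + q * + N
      exponent = e (+ toℕ u) (+ toℕ r) (q * + N) (rot-spec (- + 1) u)

  origin-fixed : U.σ (+ n) (U.σ (+ n) origin) ≗ origin
  origin-fixed u = cong origin (trans (sym (rot-+ (+ n) (+ n) u))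
    (trans (cong (λ d → rot d u) (trans N≡n+n (sym (ℤ.*-identityˡ (+ N))))) (rot-multiple (+ 1) u)))

  open Extend rotation origin

  χ-σ : ∀ d y → χ (V.σ d y) U.∼ U.σ d (χ y)
  χ-σ = Intertwining.F-σ k n s action rotation χ-linear (χ-σ₁ (U.horner₀-zero origin origin-fixed))

  χ-cong : ∀ {x y} → x V.∼ y → χ x U.∼ χ y
  χ-cong = Intertwining.F-cong k n s action rotation χ-linear (χ-σ₁ (U.horner₀-zero origin origin-fixed))

  ψ-evl : ∀ p xs x → ψ (U.evl p xs x) V.∼ V.evl p xs (ψ x)
  ψ-evl = Intertwining.F-evl k n s rotation action ψ-linear ψ-σ₁

  ψ-cong : ∀ {x y} → x U.∼ y → ψ x V.∼ ψ y
  ψ-cong = Intertwining.F-cong k n s rotation action ψ-linear ψ-σ₁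

  -- χ turns a basis vector into a Horner tail applied to δ₀; ψ moves that polynomial over to the
  -- generator, where `horner-generator-suc` evaluates it to the same basis vector.
  ψ-χ : ∀ y → ψ (χ y) V.∼ y
  ψ-χ = V.linear-ext (∘-linear ψ-linear χ-linear) id-linear λ l →
    V.∼-trans (V.≗⇒∼ (≗-cong ψ-linear (χ-basis l)))
    (V.∼-trans (ψ-evl (+ 0) (drop (suc (toℕ l)) V.cs) origin)
    (V.≗⇒∼ (λ i → trans
      (≗-cong (V.evl-linear (+ 0) (drop (suc (toℕ l)) V.cs)) (ψ-basis F.zero) i)
      (horner-generator-suc l i))))

  χ-ψ : ∀ x → χ (ψ x) U.∼ x
  χ-ψ = U.linear-ext (∘-linear χ-linear ψ-linear) id-linear λ u →
    U.∼-trans (U.≗⇒∼ (≗-cong χ-linear (ψ-basis u)))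
    (U.∼-trans (χ-σ (- + toℕ u) generator)
    (U.≗⇒∼ (λ i → trans (≗-cong (U.σ-linear (- + toℕ u)) χ-generator i) (σ-basis-zero u i))))

-- Torsion and the Laplacian of the cone

sumℤ≡sum : ∀ m (f : Fin m → ℤ) → sumℤ m f ≡ sum f
sumℤ≡sum zero    f = refl
sumℤ≡sum (suc m) f = cong (_+_ (f F.zero)) (sumℤ≡sum m (f ∘ F.suc))

sum-punchIn : ∀ m (f : Fin (suc m) → ℤ) p → sumℤ (suc m) f ≡ f p + sumℤ m (f ∘ F.punchIn p)
sum-punchIn m f p = trans (sumℤ≡sum (suc m) f)
  (trans (sum-remove {m} {p} f) (cong (_+_ (f p)) (sym (sumℤ≡sum m (f ∘ F.punchIn p)))))

-- Fraction-free Gaussian elimination on coordinate 0, by induction on the dimension. Nonvanishing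
-- of the coefficients survives because ℤ has no zero divisors.
dependence : ∀ m (v : Fin (suc m) → Fin m → ℤ) →
  ∃ λ (c : Fin (suc m) → ℤ) → (∃ λ i → c i ≢ + 0) × Σᵥ (suc m) (λ i → c i ⊙ v i) ≗ 𝟎
dependence zero    v = (λ _ → + 1) , (F.zero , λ ()) , λ ()
dependence (suc m) v with F.any? (λ i → ¬? (v i F.zero ℤ.≟ + 0))
... | no none = c , (F.suc i , c′i≢0) , combination
  where
  rec : ∃ λ (c : Fin (suc m) → ℤ) → (∃ λ i → c i ≢ + 0) ×
        Σᵥ (suc m) (λ i → c i ⊙ (v (F.suc i) ∘ F.suc)) ≗ 𝟎
  rec = dependence m (λ i → v (F.suc i) ∘ F.suc)
  -- Without a pivot coordinate 0 imposes no condition; one vector is spare and receives the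
  -- coefficient 0.
  c : Fin (suc (suc m)) → ℤ
  c F.zero    = + 0
  c (F.suc j) = proj₁ rec j
  i : Fin (suc m)
  i = proj₁ (proj₁ (proj₂ rec))
  c′i≢0 : proj₁ rec i ≢ + 0
  c′i≢0 = proj₂ (proj₁ (proj₂ rec))
  v-zero : ∀ j → v j F.zero ≡ + 0
  v-zero j with v j F.zero ℤ.≟ + 0
  ... | yes eq = eq
  ... | no neq = ⊥-elim (none (j , neq))
  combination : Σᵥ (suc (suc m)) (λ j → c j ⊙ v j) ≗ 𝟎
  combination F.zero    =
    sum-0 (suc (suc m)) (λ j → trans (cong (c j *_) (v-zero j)) (ℤ.*-zeroʳ (c j)))
  combination (F.suc l) = cong₂ _+_ (ℤ.*-zeroˡ (v F.zero (F.suc l))) (proj₂ (proj₂ rec) l)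
... | yes (p , pivot≢0) = c , (F.punchIn p i , ci≢0) , combination
  where
  pivot : ℤ
  pivot = v p F.zero
  v′ : Fin (suc m) → Fin (suc m) → ℤ
  v′ j = v (F.punchIn p j)
  -- Cross-multiplication clears coordinate 0 without dividing by the pivot.
  w : Fin (suc m) → Fin (suc m) → ℤ
  w j = pivot ⊙ v′ j ⊖ v′ j F.zero ⊙ v p
  rec : ∃ λ (c : Fin (suc m) → ℤ) → (∃ λ i → c i ≢ + 0) × Σᵥ (suc m) (λ i → c i ⊙ (w i ∘ F.suc)) ≗ 𝟎
  rec = dependence m (λ j → w j ∘ F.suc)
  c′ : Fin (suc m) → ℤ
  c′ = proj₁ rec
  i : Fin (suc m)
  i = proj₁ (proj₁ (proj₂ rec))
  S : ℤ
  S = sumℤ (suc m) (λ j → c′ j * v′ j F.zero)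
  -- These are the coefficients of Σ `c′ j` `w j` after expansion in the original vectors; those of
  -- `v p` add up to -`S`.
  c : Fin (suc (suc m)) → ℤ
  c = insertAt (λ j → pivot * c′ j) p (- S)
  c-p : c p ≡ - S
  c-p = insertAt-lookup (λ j → pivot * c′ j) p (- S)
  c-punchIn : ∀ j → c (F.punchIn p j) ≡ pivot * c′ j
  c-punchIn = insertAt-punchIn (λ j → pivot * c′ j) p (- S)
  ci≢0 : c (F.punchIn p i) ≢ + 0
  ci≢0 eq with ℤ.i*j≡0⇒i≡0∨j≡0 pivot (trans (sym (c-punchIn i)) eq)
  ... | inj₁ pivot≡0 = pivot≢0 pivot≡0
  ... | inj₂ c′i≡0   = proj₂ (proj₁ (proj₂ rec)) c′i≡0
  eliminate : ∀ l → sumℤ (suc (suc m)) (λ j → c j * v j l) ≡ sumℤ (suc m) (λ j → c′ j * w j l)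
  eliminate l = begin
    sumℤ (suc (suc m)) (λ j → c j * v j l)
      ≡⟨ sum-punchIn (suc m) (λ j → c j * v j l) p ⟩
    c p * v p l + sumℤ (suc m) (λ j → c (F.punchIn p j) * v′ j l)
      ≡⟨ cong₂ _+_ (trans (cong (_* v p l) c-p) (e₁ S (v p l)))
           (sum-cong (suc m) (λ j → cong (_* v′ j l) (c-punchIn j))) ⟩
    (- v p l) * S + sumℤ (suc m) (λ j → pivot * c′ j * v′ j l)
      ≡⟨ cong (_+ sumℤ (suc m) (λ j → pivot * c′ j * v′ j l))
           (sym (sum-* (suc m) (- v p l) (λ j → c′ j * v′ j F.zero))) ⟩
    sumℤ (suc m) (λ j → (- v p l) * (c′ j * v′ j F.zero)) + sumℤ (suc m) (λ j → pivot * c′ j * v′ j l)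
      ≡⟨ sym (sum-+ (suc m) (λ j → (- v p l) * (c′ j * v′ j F.zero)) (λ j → pivot * c′ j * v′ j l)) ⟩
    sumℤ (suc m) (λ j → (- v p l) * (c′ j * v′ j F.zero) + pivot * c′ j * v′ j l)
      ≡⟨ sum-cong (suc m) (λ j → e₂ (v p l) (c′ j) (v′ j F.zero) pivot (v′ j l)) ⟩
    sumℤ (suc m) (λ j → c′ j * w j l) ∎
    where
    open ≡-Reasoning
    e₁ : ∀ S v → - S * v ≡ (- v) * S
    e₁ = solve-∀
    e₂ : ∀ v c v₀ p v′ → (- v) * (c * v₀) + p * c * v′ ≡ c * (p * v′ - v₀ * v)
    e₂ = solve-∀
  combination : Σᵥ (suc (suc m)) (λ j → c j ⊙ v j) ≗ 𝟎
  combination F.zero    = trans (eliminate F.zero)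
    (sum-0 (suc m) (λ j → trans (cong (c′ j *_) (e pivot (v′ j F.zero))) (ℤ.*-zeroʳ (c′ j))))
    where
    e : ∀ a b → a * b - b * a ≡ + 0
    e = solve-∀
  combination (F.suc l) = trans (eliminate (F.suc l)) (proj₂ (proj₂ rec) l)

-- Adjoining x to the columns of an injective M gives linearly dependent vectors, and the coefficient of x cannot vanish.
torsion-coker : ∀ {m} {M : (Fin m → ℤ) → (Fin m → ℤ)} → Linear M → (∀ w → M w ≗ 𝟎 → w ≗ 𝟎) →
  ∀ x → ∃ λ d → 1 ≤ d × ∃ λ w → M w ≗ + d ⊙ x
torsion-coker {m} {M} ML inj x = conclude (c F.zero) refl
  where
  v : Fin (suc m) → Fin m → ℤ
  v F.zero    = x
  v (F.suc u) = M (basis u)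
  c : Fin (suc m) → ℤ
  c = proj₁ (dependence m v)
  i : Fin (suc m)
  i = proj₁ (proj₁ (proj₂ (dependence m v)))
  ci≢0 : c i ≢ + 0
  ci≢0 = proj₂ (proj₁ (proj₂ (dependence m v)))
  w : Fin m → ℤ
  w = c ∘ F.suc
  relation : ∀ l → c F.zero * x l + M w l ≡ + 0
  relation l = trans (cong (_+_ (c F.zero * x l)) (linear-expansion ML w l))
                     (proj₂ (proj₂ (dependence m v)) l)
  M-w : ∀ l → M w l ≡ - c F.zero * x l
  M-w l = e (c F.zero) (x l) (M w l) (relation l)
    where
    e : ∀ a b t → a * b + t ≡ + 0 → t ≡ - a * b
    e a b t eq = trans (e₁ a b t) (trans (cong (_+ - a * b) eq) (ℤ.+-identityˡ (- a * b)))
      where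
      e₁ : ∀ a b t → t ≡ (a * b + t) + - a * b
      e₁ = solve-∀
  vanish : c F.zero ≡ + 0 → ∀ j → c j ≡ + 0
  vanish c₀≡0 F.zero    = c₀≡0
  vanish c₀≡0 (F.suc j) = inj w (λ l → trans (M-w l) (cong (λ a → - a * x l) c₀≡0)) j
  conclude : ∀ a → c F.zero ≡ a → ∃ λ d → 1 ≤ d × ∃ λ w → M w ≗ + d ⊙ x
  conclude (+ zero)  eq = ⊥-elim (ci≢0 (vanish eq i))
  conclude (+ suc d) eq = suc d , s≤s z≤n , ℤ.-1ℤ ⊙ w , λ l →
    trans (⊙-homo ML ℤ.-1ℤ w l) (trans (ℤ.-1*i≡-i (M w l))
    (trans (cong -_ (trans (M-w l) (cong (λ a → - a * x l) eq))) (e (+ suc d) (x l))))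
    where
    e : ∀ a b → - (- a * b) ≡ a * b
    e = solve-∀
  conclude -[1+ d ]  eq = suc d , s≤s z≤n , w , λ l → trans (M-w l) (cong (λ a → - a * x l) eq)

argmax : ∀ {m} (g : Fin (suc m) → ℕ) → ∃ λ i → ∀ j → g j ≤ g i
argmax {zero}  g = F.zero , λ { F.zero → ℕ.≤-refl }
argmax {suc m} g with argmax (g ∘ F.suc)
... | i , max with ℕ.≤-total (g F.zero) (g (F.suc i))
...   | inj₁ le = F.suc i , λ { F.zero → le ; (F.suc j) → max j }
...   | inj₂ ge = F.zero , λ { F.zero → ℕ.≤-refl ; (F.suc j) → ℕ.≤-trans (max j) ge }

∣sum∣-≤ : ∀ m (f : Fin m → ℤ) b → (∀ j → ∣ f j ∣ ≤ b) → ∣ sumℤ m f ∣ ≤ m ℕ.* b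
∣sum∣-≤ zero    f b _  = z≤n
∣sum∣-≤ (suc m) f b le = ℕ.≤-trans (ℤ.∣i+j∣≤∣i∣+∣j∣ (f F.zero) (sumℤ m (f ∘ F.suc)))
  (ℕ.+-mono-≤ (le F.zero) (∣sum∣-≤ m (f ∘ F.suc) b (le ∘ F.suc)))

pos-sum : ∀ m (f : Fin m → ℕ) → + sumℕ m f ≡ sumℤ m (λ i → + f i)
pos-sum zero    f = refl
pos-sum (suc m) f = cong (_+_ (+ f F.zero)) (pos-sum m (f ∘ F.suc))

-- The diagonal entry is the degree minus `A u u`, so the split into a degree term and an adjacency
-- term is uniform in `v`, loops included.
laplacian-·ᵥ : ∀ {m} (A : Adj m) x u →
  (laplacian A ·ᵥ x) u ≡ sumℤ m (λ v → + A u v) * x u - sumℤ m (λ v → + A u v * x v)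
laplacian-·ᵥ {m} A x u = begin
  sumℤ m (λ v → laplacian A u v * x v)
    ≡⟨ sum-cong m (λ v → trans (cong (_* x v) (entry v)) (e₁ (δ (toℕ v) (toℕ u)) (+ degree A u) (+ A u v) (x v))) ⟩
  sumℤ m (λ v → δ (toℕ v) (toℕ u) * (+ degree A u * x v) + ℤ.-1ℤ * (+ A u v * x v))
    ≡⟨ sum-+ m (λ v → δ (toℕ v) (toℕ u) * (+ degree A u * x v)) (λ v → ℤ.-1ℤ * (+ A u v * x v)) ⟩
  sumℤ m (λ v → δ (toℕ v) (toℕ u) * (+ degree A u * x v)) + sumℤ m (λ v → ℤ.-1ℤ * (+ A u v * x v))
    ≡⟨ cong₂ _+_ (trans (sum-δ m (λ v → + degree A u * x v) u) (cong (_* x u) (pos-sum m (A u))))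
         (trans (sum-* m ℤ.-1ℤ (λ v → + A u v * x v)) (ℤ.-1*i≡-i _)) ⟩
  sumℤ m (λ v → + A u v) * x u - sumℤ m (λ v → + A u v * x v) ∎
  where
  open ≡-Reasoning
  entry : ∀ v → laplacian A u v ≡ δ (toℕ v) (toℕ u) * + degree A u - + A u v
  entry v with u F.≟ v
  ... | yes refl = cong (_- + A u v) (sym (trans (cong (_* + degree A u) (δ-refl (toℕ u))) (ℤ.*-identityˡ (+ degree A u))))
  ... | no  u≢v  = sym (trans (cong (λ d → d * + degree A u - + A u v) (δ-≢ (λ q → u≢v (sym (F.toℕ-injective q)))))
                              (ℤ.+-identityˡ (- + A u v)))
  e₁ : ∀ d g a x → (d * g - a) * x ≡ d * (g * x) + - + 1 * (a * x)
  e₁ = solve-∀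

module ConeLaplacian (k n′ : ℕ) (s : Fin k → ℕ) where

  open Rotation (n′ ℕ.+ (suc n′ ℕ.+ 0))

  module U = Residues k (suc n′) s rotation

  n : ℕ
  n = suc n′

  c : ℤ
  c = + (2 ℕ.* k ℕ.+ 2)

  c≡ : c ≡ + k + + k + + 2
  c≡ = cong (λ t → + (k ℕ.+ t ℕ.+ 2)) (ℕ.+-identityʳ k)

  jumps : (Fin N → ℤ) → Fin N → ℤ
  jumps x = U.σ (+ n) x ⊕ Σᵥ k (λ j → U.σ (+ s j) x ⊕ U.σ (- + s j) x)

  M-jumps : ∀ x u → U.M x u ≡ jumps x u - c * x u
  M-jumps x u = e (U.σ (+ n) x u) (c * x u) (sumℤ k (λ j → U.σ (+ s j) x u + U.σ (- + s j) x u))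
    where
    e : ∀ t a S → t - (a - S) ≡ t + S - a
    e = solve-∀

  Circ-sum : ∀ x u → sumℤ N (λ v → + Circ n k s u v * x v) ≡ jumps x u
  Circ-sum x u = trans (circulant-sum (circJumps n k s) x u) (circJumps-sum n k s x u)

  -- All 2k+1 shifts fix a constant vector, against the coefficient 2k+2.
  M-const : ∀ b → U.M (λ _ → b) ≗ λ _ → - b
  M-const b u = trans (M-jumps (λ _ → b) u) (trans
    (cong₂ (λ S a → b + S - a * b) (sum-const k (b + b)) c≡)
    (e (+ k) b))
    where
    e : ∀ k b → b + k * (b + b) - (k + k + + 2) * b ≡ - b
    e = solve-∀

  -- The degree is the adjacency matrix applied to the vector of ones, hence the case b = 1 of
  -- `M-const`; the leading 1 is the edge to the apex.
  Circ-degree : ∀ u → + 1 + sumℤ N (λ v → + Circ n k s u v) ≡ c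
  Circ-degree u = e (sumℤ N (λ v → + Circ n k s u v)) c (trans
    (cong (_- c * + 1) (trans (sum-cong N (λ v → sym (ℤ.*-identityʳ (+ Circ n k s u v)))) (Circ-sum (λ _ → + 1) u)))
    (trans (sym (M-jumps (λ _ → + 1) u)) (M-const (+ 1) u)))
    where
    e : ∀ S c → S - c * + 1 ≡ - + 1 → + 1 + S ≡ c
    e S c eq = trans (e₁ S c) (trans (cong (λ t → c + (+ 1 + t)) eq) (ℤ.+-identityʳ c))
      where
      e₁ : ∀ S c → + 1 + S ≡ c + (+ 1 + (S - c * + 1))
      e₁ = solve-∀

  L : Matrix (suc N)
  L = laplacian (cone (Circ n k s))

  L-suc : ∀ x u → (L ·ᵥ x) (F.suc u) ≡ - U.M (x ∘ F.suc) u - x F.zero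
  L-suc x u = trans (laplacian-·ᵥ (cone (Circ n k s)) x (F.suc u))
    (trans (cong₂ (λ d S → d * x (F.suc u) - (+ 1 * x F.zero + S)) (Circ-degree u) (Circ-sum (x ∘ F.suc) u))
    (trans (e (c * x (F.suc u)) (x F.zero) (jumps (x ∘ F.suc) u))
           (cong (λ t → - t - x F.zero) (sym (M-jumps (x ∘ F.suc) u)))))
    where
    e : ∀ a z S → a - (+ 1 * z + S) ≡ - (S - a) - z
    e = solve-∀

  L-zero : ∀ x → (L ·ᵥ x) F.zero ≡ + N * x F.zero - sumℤ N (x ∘ F.suc)
  L-zero x = trans (laplacian-·ᵥ (cone (Circ n k s)) x F.zero)
    (cong₂ _-_
      (cong (_* x F.zero) (trans (ℤ.+-identityˡ (sumℤ N (λ _ → + 1))) (trans (sum-const N (+ 1)) (ℤ.*-identityʳ (+ N)))))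
      (trans (cong₂ _+_ (ℤ.*-zeroˡ (x F.zero)) (sum-cong N (λ v → ℤ.*-identityˡ (x (F.suc v)))))
             (ℤ.+-identityˡ (sumℤ N (x ∘ F.suc)))))

  M-sum : ∀ x → sumℤ N (U.M x) ≡ - sumℤ N x
  M-sum x = begin
    sumℤ N (U.M x)
      ≡⟨ trans (sum-cong N (λ u → trans (M-jumps x u) (cong (_+_ (jumps x u)) (ℤ.neg-distribˡ-* c (x u)))))
           (sum-+ N (jumps x) (λ u → - c * x u)) ⟩
    sumℤ N (jumps x) + sumℤ N (λ u → - c * x u)
      ≡⟨ cong₂ _+_ (trans (sum-+ N (U.σ (+ n) x) (Σᵥ k shifts))
             (cong₂ _+_ (σ-sum (+ n) x) (trans (sum-swap N k (λ u j → shifts j u)) (trans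
               (sum-cong k (λ j → trans (sum-+ N (U.σ (+ s j) x) (U.σ (- + s j) x))
                                        (cong₂ _+_ (σ-sum (+ s j) x) (σ-sum (- + s j) x))))
               (sum-const k (sumℤ N x + sumℤ N x))))))
           (trans (sum-* N (- c) x) (cong (λ a → - a * sumℤ N x) c≡)) ⟩
    sumℤ N x + + k * (sumℤ N x + sumℤ N x) + - (+ k + + k + + 2) * sumℤ N x
      ≡⟨ e (sumℤ N x) (+ k) ⟩
    - sumℤ N x ∎
    where
    open ≡-Reasoning
    shifts : Fin k → Fin N → ℤ
    shifts j = U.σ (+ s j) x ⊕ U.σ (- + s j) x
    e : ∀ S k → S + k * (S + S) + - (k + k + + 2) * S ≡ - S
    e = solve-∀

  L-sum : ∀ x → sumℤ (suc N) (L ·ᵥ x) ≡ + 0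
  L-sum x = trans (cong₂ _+_ (L-zero x) rest) (e (+ N) (x F.zero) (sumℤ N (x ∘ F.suc)))
    where
    rest : sumℤ N (λ u → (L ·ᵥ x) (F.suc u)) ≡ sumℤ N (x ∘ F.suc) + + N * - x F.zero
    rest = trans (sum-cong N (L-suc x)) (trans (sum-+ N (λ u → - U.M (x ∘ F.suc) u) (λ _ → - x F.zero))
      (cong₂ _+_ (trans (sum-cong N (λ u → sym (ℤ.-1*i≡-i (U.M (x ∘ F.suc) u))))
                 (trans (sum-* N ℤ.-1ℤ (U.M (x ∘ F.suc))) (trans (ℤ.-1*i≡-i (sumℤ N (U.M (x ∘ F.suc))))
                 (trans (cong -_ (M-sum (x ∘ F.suc))) (ℤ.neg-involutive (sumℤ N (x ∘ F.suc)))))))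
                 (sum-const N (- x F.zero))))
    e : ∀ N z S → N * z - S + (S + N * - z) ≡ + 0
    e = solve-∀

  -- At a coordinate where the absolute value of `w` takes its maximum `g`, the equation bounds
  -- (2k+2)`g` by the 2k+1 shifted entries, each at most `g`. Hence `g` = 0.
  M-injective : ∀ w → U.M w ≗ 𝟎 → w ≗ 𝟎
  M-injective w Mw≡0 u = ℤ.∣i∣≡0⇒i≡0 (ℕ.n≤0⇒n≡0 (ℕ.≤-trans (max u) (ℕ.≤-reflexive g≡0)))
    where
    i : Fin N
    i = proj₁ (argmax (λ j → ∣ w j ∣))
    max : ∀ j → ∣ w j ∣ ≤ ∣ w i ∣
    max = proj₂ (argmax (λ j → ∣ w j ∣))
    g : ℕ
    g = ∣ w i ∣
    balance : jumps w i ≡ c * w i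
    balance = ℤ.i-j≡0⇒i≡j (jumps w i) (c * w i) (trans (sym (M-jumps w i)) (Mw≡0 i))
    bound : ∣ jumps w i ∣ ≤ g ℕ.+ k ℕ.* (g ℕ.+ g)
    bound = ℕ.≤-trans (ℤ.∣i+j∣≤∣i∣+∣j∣ (U.σ (+ n) w i) (sumℤ k (λ j → U.σ (+ s j) w i + U.σ (- + s j) w i)))
      (ℕ.+-mono-≤ (max (rot (+ n) i)) (∣sum∣-≤ k _ (g ℕ.+ g) (λ j →
        ℕ.≤-trans (ℤ.∣i+j∣≤∣i∣+∣j∣ (U.σ (+ s j) w i) (U.σ (- + s j) w i))
                  (ℕ.+-mono-≤ (max (rot (+ s j) i)) (max (rot (- + s j) i))))))
    e : ∀ k g → (2 ℕ.* k ℕ.+ 2) ℕ.* g ≡ g ℕ.+ k ℕ.* (g ℕ.+ g) ℕ.+ g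
    e = ℕ-solve-∀
    g≡0 : g ≡ 0
    g≡0 = ℕ.n≤0⇒n≡0 (ℕ.+-cancelˡ-≤ (g ℕ.+ k ℕ.* (g ℕ.+ g)) g 0 (ℕ.≤-trans
      (ℕ.≤-reflexive (trans (sym (e k g)) (trans (sym (ℤ.abs-* c (w i))) (cong ∣_∣ (sym balance)))))
      (ℕ.≤-trans bound (ℕ.≤-reflexive (sym (ℕ.+-identityʳ (g ℕ.+ k ℕ.* (g ℕ.+ g))))))))

  restrict : ∀ {b} → InIm L b → ∃ λ w → U.M w ≗ b ∘ F.suc
  restrict {b} (x , Lx≡b) = w , λ u →
    trans (⊕-homo U.M-linear (ℤ.-1ℤ ⊙ x′) (λ _ → x F.zero) u)
    (trans (cong₂ _+_ (trans (⊙-homo U.M-linear ℤ.-1ℤ x′ u) (ℤ.-1*i≡-i (U.M x′ u))) (M-const (x F.zero) u))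
    (trans (sym (L-suc x u)) (Lx≡b (F.suc u))))
    where
    x′ : Fin N → ℤ
    x′ = x ∘ F.suc
    w : Fin N → ℤ
    -- On the rows other than the apex `L` is -`M` minus the apex coordinate; by `M-const` that
    -- subtraction is `M` of the constant vector `x F.zero`.
    w = ℤ.-1ℤ ⊙ x′ ⊕ (λ _ → x F.zero)

  -- A preimage with apex coordinate 0 settles all rows but the apex row. That row follows, because
  -- the entries of `b` and of any vector in im `L` both add up to 0.
  extend : ∀ {b} → sumℤ (suc N) b ≡ + 0 → (∃ λ w → U.M w ≗ b ∘ F.suc) → InIm L b
  extend {b} Σb≡0 (w , Mw≡b) = x , λ { F.zero → at-zero ; (F.suc u) → at-suc u }
    where
    x : Fin (suc N) → ℤ
    x F.zero    = + 0
    x (F.suc u) = ℤ.-1ℤ * w u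
    at-suc : ∀ u → (L ·ᵥ x) (F.suc u) ≡ b (F.suc u)
    at-suc u = trans (L-suc x u) (trans (cong (λ t → - t - + 0)
        (trans (⊙-homo U.M-linear ℤ.-1ℤ w u) (ℤ.-1*i≡-i (U.M w u))))
      (trans (e (U.M w u)) (Mw≡b u)))
      where
      e : ∀ a → - - a - + 0 ≡ a
      e = solve-∀
    at-zero : (L ·ᵥ x) F.zero ≡ b F.zero
    at-zero = ∙-cancelʳ (sumℤ N (b ∘ F.suc)) ((L ·ᵥ x) F.zero) (b F.zero)
      (trans (cong (_+_ ((L ·ᵥ x) F.zero)) (sum-cong N (λ u → sym (at-suc u))))
             (trans (L-sum x) (sym Σb≡0)))

  -- The coordinate sum kills im `L` and takes values in ℤ, which is torsion-free.
  torsion⇒sum≡0 : ∀ {v} → Torsion L v → sumℤ (suc N) v ≡ + 0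
  torsion⇒sum≡0 {v} (suc d , _ , x , Lx≡dv) = ℤ.*-cancelˡ-≡ (+ suc d) (sumℤ (suc N) v) (+ 0)
    (trans (sym (sum-* (suc N) (+ suc d) v)) (trans (sym (sum-cong (suc N) Lx≡dv))
      (trans (L-sum x) (sym (ℤ.*-zeroʳ (+ suc d))))))

  -- Injectivity of `M` makes its cokernel torsion, so some multiple of `v` off the apex lies in im
  -- `M`; the vanishing sum carries this back to `L`.
  sum≡0⇒torsion : ∀ {v} → sumℤ (suc N) v ≡ + 0 → Torsion L v
  sum≡0⇒torsion {v} Σv≡0 = lift (torsion-coker U.M-linear M-injective (v ∘ F.suc))
    where
    lift : (∃ λ d → 1 ≤ d × ∃ λ w → U.M w ≗ + d ⊙ (v ∘ F.suc)) → Torsion L v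
    lift (d , 1≤d , p) = d , 1≤d , extend
      (trans (sum-* (suc N) (+ d) v) (trans (cong (+ d *_) Σv≡0) (ℤ.*-zeroʳ (+ d)))) p

-- The isomorphism between the Jacobian and the cokernel

module Isomorphism (k n′ : ℕ) (s : Fin k → ℕ) (bim : Bimonic (polyP k s))
  (B : Matrix (span (polyP k s)))
  (AB≡I : ∀ i j → (companion (polyP k s) ·ₘ B) i j ≡ Iₘ i j) where

  open Correspondence k n′ s bim B AB≡I
  open Extend rotation origin using (χ)
  open ConeLaplacian k n′ s using (L; restrict; extend; torsion⇒sum≡0; sum≡0⇒torsion)

  jacobian : PresGroup
  jacobian = JacOf L

  cokernel : PresGroup
  cokernel = Coker (cokerMatrix n k s A B)

  from-coker : ∀ {x y} → x ≈⟨ cokerMatrix n k s A B ⟩ y → x V.∼ y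
  from-coker (w , p) = w V., λ i → trans (sym (cokerMatrix-M w i)) (p i)

  to-coker : ∀ {x y} → x V.∼ y → x ≈⟨ cokerMatrix n k s A B ⟩ y
  to-coker (w V., p) = w , λ i → trans (cokerMatrix-M w i) (p i)

  map-cong : ∀ x y → x ≈⟨ L ⟩ y → ψ (x ∘ F.suc) V.∼ ψ (y ∘ F.suc)
  map-cong x y x≈y = ψ-cong {x ∘ F.suc} {y ∘ F.suc} (proj₁ (restrict x≈y) U., proj₂ (restrict x≈y))

  map-injective : ∀ x y → sumℤ (suc N) x ≡ + 0 → sumℤ (suc N) y ≡ + 0 →
                  ψ (x ∘ F.suc) V.∼ ψ (y ∘ F.suc) → x ≈⟨ L ⟩ y
  map-injective x y Σx≡0 Σy≡0 p = extend Σ≡0 (U._∼_.preimage q , U._∼_.M-preimage q)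
    where
    q : (x ∘ F.suc) U.∼ (y ∘ F.suc)
    q = U.∼-trans (U.∼-sym (χ-ψ (x ∘ F.suc))) (U.∼-trans (χ-cong p) (χ-ψ (y ∘ F.suc)))
    Σ≡0 : sumℤ (suc N) (x ⊖ y) ≡ + 0
    Σ≡0 = trans (sum-cong (suc N) (λ i → cong (_+_ (x i)) (sym (ℤ.-1*i≡-i (y i)))))
      (trans (sum-+ (suc N) x (ℤ.-1ℤ ⊙ y))
      (cong₂ _+_ Σx≡0 (trans (sum-* (suc N) ℤ.-1ℤ y) (cong (ℤ.-1ℤ *_) Σy≡0))))

  -- The apex entry is forced: only coordinate sum 0 makes the class torsion.
  lift : (Fin N → ℤ) → Fin (suc N) → ℤ
  lift x F.zero    = - sumℤ N x
  lift x (F.suc u) = x u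

  isomorphism : jacobian ≅ cokernel
  isomorphism = record
    { f          = λ { (x , _) → ψ (x ∘ F.suc) , tt }
    ; cong       = λ { (x , _) (y , _) x≈y → to-coker (map-cong x y x≈y) }
    ; hom        = λ { (x , _) (y , _) (z , _) z≡ (w , _) w≡ → to-coker (V.≗⇒∼ (λ i →
                     trans (≗-cong ψ-linear (z≡ ∘ F.suc) i)
                     (trans (⊕-homo ψ-linear (x ∘ F.suc) (y ∘ F.suc) i) (sym (w≡ i))))) }
    ; injective  = λ { (x , tx) (y , ty) p →
                     map-injective x y (torsion⇒sum≡0 tx) (torsion⇒sum≡0 ty) (from-coker p) }
    ; surjective = λ { (y , _) →
                     (lift (χ y) , sum≡0⇒torsion (ℤ.+-inverseˡ (sumℤ N (χ y)))) , to-coker (ψ-χ y) }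
    }

theorem4 : (k n : ℕ) → 1 ≤ k → (s : Fin k → ℕ) →
           (∀ j → 1 ≤ s j) → (∀ i j → toℕ i < toℕ j → s i < s j) → (∀ j → s j < n) →
           Bimonic (polyP k s) ×
           ((B : Matrix (span (polyP k s))) →
            (∀ i j → (companion (polyP k s) ·ₘ B) i j ≡ Iₘ i j) →
            JacOf (laplacian (cone (Circ n k s)))
              ≅ Coker (cokerMatrix n k s (companion (polyP k s)) B))
-- A jump below `n` exists, so `n` is positive.
theorem4 (suc k) zero     _ s 1≤s mono s<n = ⊥-elim (ℕ.n≮0 (s<n F.zero))
theorem4 (suc k) (suc n′) _ s 1≤s mono s<n = bim , Isomorphism.isomorphism (suc k) n′ s bim
  where
  l : Fin (suc k)
  -- The last jump is the largest one and determines the degree of q.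
  l = F.fromℕ k
  bim : Bimonic (polyP (suc k) s)
  bim = Coefficients.polyP-bimonic (suc k) s l
    (λ j j≢l → mono j l (ℕ.≤∧≢⇒< (F.≤fromℕ j) (j≢l ∘ F.toℕ-injective))) (1≤s l)
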